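{- Let $\mathcal{M}=(S,AP,\delta_{\mathcal M},s_{init})$ be a Markov chain and $\mathcal{A}$ a deterministic Rabin automaton over the same set $AP$, such that any two labels $c_1,c_2\in\Sigma=2^{AP}$ with $c_1\sim_{\mathcal A}c_2$ are equal. Let $e$ be an edge of $\mathcal M$ that is replaceable with respect to $\mathcal A$, and let $\mathbb{R}(\mathcal M,e)$ be the replaced Markov chain. Then $$\mathbb{P}(\mathcal M\vDash\mathcal A)=\mathbb{P}(\mathbb{R}(\mathcal M,e)\vDash\mathcal A).$$
   Context: Markov chains. $AP$ is a finite set of atomic propositions and $\Sigma=2^{AP}$ is the set of labels. A (transition-labeled) Markov chain (MC) is $\mathcal M=(S,AP,\delta_{\mathcal M},s_{init})$ with $S$ a finite set of states, $s_{init}\in S$, and $\delta_{\mathcal M}\colon S\times\Sigma\times S\to[0,1]\cap\mathbb Q$ such that $\sum_{(c,s_2)}\delta_{\mathcal M}(s_1,c,s_2)=1$ for every $s_1\in S$. An edge is a triple $(s_1,c,s_2)$ with $\delta_{\mathcal M}(s_1,c,s_2)>0$. A (finite or infinite) path is a finite or infinite sequence of edges in which the target of each edge is the source of the next. For a finite path $p$, $\mathrm{head}(p)$ and $\mathrm{last}(p)$ are its first and last states; the trace $\mathrm O(p)$ of a path is the sequence of labels along it. For a finite path $p$, $\mathbb P(p)$ is the product of the probabilities $\delta_{\mathcal M}$ of its edges; this is the measure of the cylinder set $\mathrm{Cyl}(p)$ of infinite paths having $p$ as a prefix. Automata. A deterministic Rabin automaton (DRA) is $\mathcal A=(Q,AP,\Delta,q_{init},Acc)$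 with $Q$ a finite set of positions, $\Delta\colon Q\times\Sigma\to Q$, $q_{init}\in Q$, and $Acc=(L_i,U_i)_{i\in I}\subseteq 2^Q\times 2^Q$. $\Delta$ is extended to words by $\Delta(q,\varepsilon)=q$, $\Delta(q,c\cdot t)=\Delta(\Delta(q,c),t)$. An $\omega$-word is accepted ($\in\mathcal L(\mathcal A)$) if for its run from $q_{init}$ there is $i\in I$ such that some position of $L_i$ occurs infinitely often and every position of $U_i$ occurs only finitely often. Satisfaction probability. $\mathbb P(\mathcal M\vDash\mathcal A)$ is the probability of the set of infinite paths of $\mathcal M$ starting from $s_{init}$ whose trace is in $\mathcal L(\mathcal A)$, under the usual measure determined by cylinder sets. Compatibility. A non-empty word $t\in\Sigma^+$ is acceptance-preserving if for every $q\in Q$, every non-empty prefix $t'$ of $t$, and every $X\in\{L_i,U_i\}$ with $i\in I$: $\Delta(q,t')\in X$ implies $\Delta(q,t)\in X$. For acceptance-preserving words $t_1,t_2$, $t_1\sim_{\mathcal A}t_2$ means $\Delta(q,t_1)=\Delta(q,t_2)$ for all $q\in Q$ (single labels are always acceptance-preserving; $t_1\not\sim_{\mathcal A}t_2$ holds in particular if one of them is not acceptance-preserving). Replaceable edge. An edge $e=(s_e,c_e,s'_e)$ of $\mathcal M$ is replaceable (w.r.t. $\mathcal A$) if $s_e\neq s'_e$ and there is a set $T$ of finite paths of $\mathcal M$, each having $e$ as a prefix, such that: (1) every infinite path that starts with $e$ has a prefix in $T$; (2) for every $p\in T$, $\mathrm O(p)$ is acceptance-preserving and $\mathrm O(p)\sim_{\mathcal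 A}c$ for some $c\in\Sigma$; (3) for every $p\in T$, every strict prefix $p'\neq e$ of $p$ and every $c\in\Sigma$, $\mathrm O(p')\not\sim_{\mathcal A}c$; (4) $e\notin T$; (5) for every $p\in T$, the state $s'_e$ appears only once in $p$. If $e$ is replaceable this set $T$ is unique; it is denoted $MCCS(e,\mathcal A)$. Replaced MC. For a replaceable edge $e=(s_e,c_e,s'_e)$, put $T(c,s)=\{p\in MCCS(e,\mathcal A): \mathrm O(p)\sim_{\mathcal A}c,\ \mathrm{last}(p)=s\}$. Then $\mathbb R(\mathcal M,e)=(S,AP,\delta,s_{init})$ with $\delta(s,c,s')=0$ if $(s,c,s')=e$; $\delta(s,c,s')=\delta_{\mathcal M}(s,c,s')$ if $s\neq s_e$; and $\delta(s,c,s')=\delta_{\mathcal M}(s_e,c,s')+\sum_{p\in T(c,s')}\mathbb P(p)$ otherwise. -}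

module Defs where

import Algebra.Properties.Group as GroupProperties
open import Data.Bool using (true; false; if_then_else_)
import Data.Bool.Properties as Bool
open import Data.Empty using (⊥-elim)
open import Data.Fin using (Fin; toℕ)
import Data.Fin.Properties as Fin
open import Data.Fin.Subset using (Subset; _∈_; _∪_; ⁅_⁆) renaming (⊥ to ∅)
open import Data.Fin.Subset.Properties
  using (_∈?_; ∉⊥; x∈p∪q⁺; x∈p∪q⁻; x∈⁅x⁆; x∈⁅y⁆⇒x≡y; ∪-assoc; ∪-identityˡ; ∪-identityʳ)
open import Data.List
  using (List; []; _∷_; [_]; _++_; _∷ʳ_; length; map; filter; last; foldr; applyUpTo;
         cartesianProduct; cartesianProductWith; allFin; deduplicate)
import Data.List.Properties as List
open import Data.List.Membership.Propositional using () renaming (_∈_ to _∈ₗ_)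
open import Data.List.Membership.Propositional.Properties
  using (∈-cartesianProduct⁺; ∈-cartesianProductWith⁺; ∈-allFin; ∈-filter⁺; ∈-filter⁻;
         ∈-deduplicate⁺; ∈-deduplicate⁻)
open import Data.List.Relation.Binary.Prefix.Heterogeneous using (Prefix; []; _∷_)
open import Data.List.Relation.Binary.Prefix.Heterogeneous.Properties using (prefix?)
open import Data.List.Relation.Unary.All using (All; []; _∷_)
import Data.List.Relation.Unary.All as All
open import Data.List.Relation.Unary.AllPairs using ([]; _∷_)
open import Data.List.Relation.Unary.Any using (here; there; index)
import Data.List.Relation.Unary.Any as Any
import Data.List.Relation.Unary.Any.Properties as Any
open import Data.List.Relation.Unary.Linked using (Linked; []; [-]; _∷_; linked?)
import Data.List.Relation.Unary.Linked as Linked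
open import Data.List.Relation.Unary.Unique.Propositional using (Unique)
import Data.List.Relation.Unary.Unique.Propositional.Properties as Unique
import Data.List.Relation.Unary.Unique.DecPropositional.Properties as DecUnique
open import Data.Maybe using (Maybe; just)
import Data.Maybe as Maybe
import Data.Maybe.Properties as Maybe
open import Data.Nat using (ℕ; zero; suc; z≤n; s≤s)
import Data.Nat as ℕ
import Data.Nat.Properties as ℕ
open import Data.Product using (∃; ∃₂; Σ-syntax; _×_; _,_; proj₁; proj₂)
import Data.Product.Properties as Product
open import Data.Rational using (ℚ; 0ℚ; 1ℚ; _+_; _*_; _≤_; _<_)
import Data.Rational.Properties as ℚ
open import Data.Sum using (inj₁; inj₂)
open import Data.Unit using (⊤)
open import Data.Vec using (Vec; []; _∷_; tabulate; lookup)
import Data.Vec.Properties as Vec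
open import Function using (_∘_; _⇔_; mk⇔; Equivalence)
open import Relation.Binary.Definitions using (DecidableEquality; tri<; tri≈; tri>)
open import Relation.Binary.PropositionalEquality
  using (_≡_; _≢_; refl; sym; trans; cong; cong₂; subst; module ≡-Reasoning)
open import Relation.Nullary using (¬_; Dec; yes; no; does; contradiction)
open import Relation.Nullary.Decidable using (_×-dec_; _→-dec_; map′)

------------------------------------------------------------------------
-- Finite sums and enumerations

∑ : {A : Set} → List A → (A → ℚ) → ℚ
∑ xs f = foldr (λ x acc → f x + acc) 0ℚ xs

vecs : {A : Set} → List A → (n : ℕ) → List (Vec A n)
vecs xs zero    = [] ∷ []
vecs xs (suc n) = cartesianProductWith _∷_ xs (vecs xs n)

-- The labels 2^AP, for AP = Fin n.

Label : ℕ → Set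
Label n = Subset n

labels : (n : ℕ) → List (Label n)
labels = vecs (true ∷ false ∷ [])

------------------------------------------------------------------------
-- Markov chains with set of states Fin k

record MC (n k : ℕ) : Set where
  field
    δ     : Fin k → Label n → Fin k → ℚ
    0≤δ   : ∀ s c s′ → 0ℚ ≤ δ s c s′
    δ≤1   : ∀ s c s′ → δ s c s′ ≤ 1ℚ
    ∑δ≡1  : ∀ s → ∑ (cartesianProduct (labels n) (allFin k)) (λ (c , s′) → δ s c s′) ≡ 1ℚ
    sinit : Fin k

Triple : ℕ → ℕ → Set
Triple n k = Fin k × Label n × Fin k

module _ {n k : ℕ} where

  src tgt : Triple n k → Fin k
  src (s , _ , _)  = s
  tgt (_ , _ , s′) = s′

  label : Triple n k → Label n
  label (_ , c , _) = c

  trace : List (Triple n k) → List (Label n)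
  trace = map label

  lastState : List (Triple n k) → Maybe (Fin k)
  lastState p = Maybe.map tgt (last p)

  statesOf : List (Triple n k) → List (Fin k)
  statesOf []      = []
  statesOf (x ∷ p) = src x ∷ map tgt (x ∷ p)

  occurrences : Fin k → List (Triple n k) → ℕ
  occurrences s p = length (filter (Fin._≟ s) (statesOf p))

  StartsAt : Fin k → List (Triple n k) → Set
  StartsAt s []      = ⊤
  StartsAt s (x ∷ _) = src x ≡ s

  _≟ₜ_ : DecidableEquality (Triple n k)
  _≟ₜ_ = Product.≡-dec Fin._≟_ (Product.≡-dec (Vec.≡-dec Bool._≟_) Fin._≟_)

_⊑_ : {A : Set} → List A → List A → Set
_⊑_ = Prefix _≡_

module _ {n k : ℕ} (M : MC n k) where
  open MC M

  IsEdge : Triple n k → Set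
  IsEdge (s , c , s′) = 0ℚ < δ s c s′

  IsPath : List (Triple n k) → Set
  IsPath p = All IsEdge p × Linked (λ x y → tgt x ≡ src y) p

  IsInfPath : (ℕ → Triple n k) → Set
  IsInfPath ω = ∀ i → IsEdge (ω i) × tgt (ω i) ≡ src (ω (suc i))

  ℙ : List (Triple n k) → ℚ
  ℙ = foldr (λ (s , c , s′) acc → δ s c s′ * acc) 1ℚ

------------------------------------------------------------------------
-- Deterministic Rabin automata with set of positions Fin m

record DRA (n m : ℕ) : Set where
  field
    Δ     : Fin m → Label n → Fin m
    qinit : Fin m
    pairs : ℕ
    L U   : Fin pairs → Subset m

  Δ* : Fin m → List (Label n) → Fin m
  Δ* q []      = q
  Δ* q (c ∷ t) = Δ* (Δ q c) t

  run : (ℕ → Label n) → ℕ → Fin m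
  run w zero    = qinit
  run w (suc i) = Δ (run w i) (w i)

InfinitelyOften FinitelyOften : {m : ℕ} → (ℕ → Fin m) → Fin m → Set
InfinitelyOften ρ q = ∀ i → ∃ λ j → i ℕ.≤ j × ρ j ≡ q
FinitelyOften   ρ q = ∃ λ i → ∀ j → i ℕ.≤ j → ρ j ≢ q

module _ {n m : ℕ} (A : DRA n m) where
  open DRA A

  Accepts : (ℕ → Label n) → Set
  Accepts w = ∃ λ i →
    (∃ λ q → q ∈ L i × InfinitelyOften (run w) q) ×
    (∀ q → q ∈ U i → FinitelyOften (run w) q)

  AcceptancePreserving : List (Label n) → Set
  AcceptancePreserving t = t ≢ [] ×
    (∀ q t′ → t′ ≢ [] → t′ ⊑ t → ∀ i →
      (Δ* q t′ ∈ L i → Δ* q t ∈ L i) × (Δ* q t′ ∈ U i → Δ* q t ∈ U i))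

  _∼_ : List (Label n) → List (Label n) → Set
  t₁ ∼ t₂ = AcceptancePreserving t₁ × AcceptancePreserving t₂ × (∀ q → Δ* q t₁ ≡ Δ* q t₂)

  LabelsSeparated : Set
  LabelsSeparated = ∀ c₁ c₂ → [ c₁ ] ∼ [ c₂ ] → c₁ ≡ c₂

------------------------------------------------------------------------
-- Satisfaction probability
--
-- The measure determined by the cylinder sets is the restriction to the
-- measurable sets of the outer measure
--   μ*(X) = inf { ∑ᵢ ℙ(pᵢ) | X ⊆ ⋃ᵢ Cyl(pᵢ) },
-- the families (pᵢ) being finite or countable.  The set of paths whose
-- trace is accepted is Borel, so its outer measure is its probability.
-- A real number is given by the set of rationals strictly above it, and
-- two reals are equal when these sets agree.

Real : Set₁
Real = ℚ → Set

_≃_ : Real → Real → Set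
x ≃ y = ∀ r → x r ⇔ y r

module _ {n k : ℕ} (M : MC n k) where
  open MC M

  PathsFromInit : Set
  PathsFromInit = Σ[ ω ∈ (ℕ → Triple n k) ] IsInfPath M ω × src (ω 0) ≡ sinit

  -- nothing stands for the empty set and just p for Cyl(p).

  Family : Set
  Family = ℕ → Maybe (Σ[ p ∈ List (Triple n k) ] IsPath M p × StartsAt sinit p)

  InCylinder : PathsFromInit → List (Triple n k) → Set
  InCylinder (ω , _) p = applyUpTo ω (length p) ≡ p

  Covers : Family → (PathsFromInit → Set) → Set
  Covers C X = ∀ ω → X ω → ∃₂ λ i p → C i ≡ just p × InCylinder ω (proj₁ p)

  partialMass : Family → ℕ → ℚ
  partialMass C j = ∑ (applyUpTo C j) (Maybe.maybe (ℙ M ∘ proj₁) 0ℚ)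

  μ* : (PathsFromInit → Set) → Real
  μ* X r = ∃ λ C → Covers C X × ∃ λ r′ → r′ < r × (∀ j → partialMass C j ≤ r′)

ℙ[_⊨_] : {n k m : ℕ} → MC n k → DRA n m → Real
ℙ[ M ⊨ A ] = μ* M (λ (ω , _) → Accepts A (label ∘ ω))

------------------------------------------------------------------------
-- Replaceable edges

module _ {n k m : ℕ} (M : MC n k) (A : DRA n m) (e : Triple n k) where

  record IsMCCS (T : List (Triple n k) → Set) : Set where
    field
      paths     : ∀ {p} → T p → IsPath M p × [ e ] ⊑ p
      exhaust   : ∀ ω → IsInfPath M ω → ω 0 ≡ e → ∃ λ i → T (applyUpTo ω i)
      simulated : ∀ {p} → T p →
                  AcceptancePreserving A (trace p) × ∃ λ c → _∼_ A (trace p) [ c ]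
      minimal   : ∀ {p} → T p → ∀ p′ → p′ ⊑ p → p′ ≢ p → p′ ≢ [ e ] →
                  ∀ c → ¬ _∼_ A (trace p′) [ c ]
      e∉T       : ¬ T [ e ]
      once      : ∀ {p} → T p → occurrences (tgt e) p ≡ 1

  record Replaceable : Set₁ where
    field
      src≢tgt : src e ≢ tgt e
      MCCS    : List (Triple n k) → Set
      isMCCS  : IsMCCS MCCS

------------------------------------------------------------------------
-- Sums

when : {P : Set} → Dec P → ℚ → ℚ
when (yes _) v = v
when (no  _) v = 0ℚ

when-yes : {P : Set} (d : Dec P) {v : ℚ} → P → when d v ≡ v
when-yes (yes _) p = refl
when-yes (no ¬p) p = contradiction p ¬p

when-no : {P : Set} (d : Dec P) {v : ℚ} → ¬ P → when d v ≡ 0ℚ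
when-no (yes p) ¬p = contradiction p ¬p
when-no (no _)  ¬p = refl

module _ {A : Set} where
  open ≡-Reasoning

  ∑-cong : ∀ (xs : List A) {f g : A → ℚ} → (∀ x → x ∈ₗ xs → f x ≡ g x) → ∑ xs f ≡ ∑ xs g
  ∑-cong []       h = refl
  ∑-cong (x ∷ xs) h = cong₂ _+_ (h x (here refl)) (∑-cong xs λ y → h y ∘ there)

  ∑-zero : ∀ (xs : List A) → ∑ xs (λ _ → 0ℚ) ≡ 0ℚ
  ∑-zero []       = refl
  ∑-zero (x ∷ xs) = trans (ℚ.+-identityˡ _) (∑-zero xs)

  ∑-+ : ∀ (xs : List A) (f g : A → ℚ) → ∑ xs (λ x → f x + g x) ≡ ∑ xs f + ∑ xs g
  ∑-+ []       f g = refl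
  ∑-+ (x ∷ xs) f g = begin
    (f x + g x) + ∑ xs (λ y → f y + g y)  ≡⟨ cong ((f x + g x) +_) (∑-+ xs f g) ⟩
    (f x + g x) + (∑ xs f + ∑ xs g)       ≡⟨ ℚ.+-assoc (f x) (g x) _ ⟩
    f x + (g x + (∑ xs f + ∑ xs g))       ≡⟨ cong (f x +_) (sym (ℚ.+-assoc (g x) _ _)) ⟩
    f x + ((g x + ∑ xs f) + ∑ xs g)       ≡⟨ cong (λ z → f x + (z + ∑ xs g)) (ℚ.+-comm (g x) _) ⟩
    f x + ((∑ xs f + g x) + ∑ xs g)       ≡⟨ cong (f x +_) (ℚ.+-assoc (∑ xs f) _ _) ⟩
    f x + (∑ xs f + (g x + ∑ xs g))       ≡⟨ sym (ℚ.+-assoc (f x) _ _) ⟩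
    (f x + ∑ xs f) + (g x + ∑ xs g)       ∎

  ∑-*ˡ : ∀ (xs : List A) a (f : A → ℚ) → ∑ xs (λ x → a * f x) ≡ a * ∑ xs f
  ∑-*ˡ []       a f = sym (ℚ.*-zeroʳ a)
  ∑-*ˡ (x ∷ xs) a f =
    trans (cong (a * f x +_) (∑-*ˡ xs a f)) (sym (ℚ.*-distribˡ-+ a (f x) (∑ xs f)))

  ∑-≥0 : ∀ (xs : List A) {f : A → ℚ} → (∀ x → 0ℚ ≤ f x) → 0ℚ ≤ ∑ xs f
  ∑-≥0 []       h = ℚ.≤-refl
  ∑-≥0 (x ∷ xs) h = ℚ.+-mono-≤ (h x) (∑-≥0 xs h)

  term≤∑ : ∀ (xs : List A) {f : A → ℚ} → (∀ x → 0ℚ ≤ f x) → ∀ {x} → x ∈ₗ xs → f x ≤ ∑ xs f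
  term≤∑ (x ∷ xs) {f} h (here refl) =
    subst (_≤ f x + ∑ xs f) (ℚ.+-identityʳ (f x)) (ℚ.+-monoʳ-≤ (f x) (∑-≥0 xs h))
  term≤∑ (y ∷ xs) {f} h (there x∈xs) =
    ℚ.≤-trans (term≤∑ xs h x∈xs)
      (subst (_≤ f y + ∑ xs f) (ℚ.+-identityˡ (∑ xs f)) (ℚ.+-monoˡ-≤ (∑ xs f) (h y)))

  -- The sum has at most one nonzero term.

  ∑-single : ∀ (xs : List A) (f : A → ℚ) → Unique xs → ∀ {x} → x ∈ₗ xs →
             (∀ y → y ∈ₗ xs → y ≢ x → f y ≡ 0ℚ) → ∑ xs f ≡ f x
  ∑-single (x ∷ xs) f (x∉ ∷ u) (here refl) h = begin
    f x + ∑ xs f          ≡⟨ cong (f x +_) (∑-cong xs λ y y∈ → h y (there y∈) λ y≡x → All.lookup x∉ y∈ (sym y≡x)) ⟩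
    f x + ∑ xs (λ _ → 0ℚ) ≡⟨ cong (f x +_) (∑-zero xs) ⟩
    f x + 0ℚ              ≡⟨ ℚ.+-identityʳ _ ⟩
    f x                   ∎
  ∑-single (z ∷ xs) f (z∉ ∷ u) {x} (there x∈) h = begin
    f z + ∑ xs f  ≡⟨ cong (_+ ∑ xs f) (h z (here refl) (All.lookup z∉ x∈)) ⟩
    0ℚ + ∑ xs f   ≡⟨ ℚ.+-identityˡ _ ⟩
    ∑ xs f        ≡⟨ ∑-single xs f u x∈ (λ y → h y ∘ there) ⟩
    f x           ∎

  ∑-filter : ∀ {P : A → Set} (P? : ∀ x → Dec (P x)) (xs : List A) (f : A → ℚ) →
             ∑ (filter P? xs) f ≡ ∑ xs (λ x → when (P? x) (f x))
  ∑-filter P? []       f = refl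
  ∑-filter P? (x ∷ xs) f with P? x
  ... | yes _ = cong (f x +_) (∑-filter P? xs f)
  ... | no _  = trans (∑-filter P? xs f) (sym (ℚ.+-identityˡ _))

∑-swap : {A B : Set} (xs : List A) (ys : List B) (f : A → B → ℚ) →
         ∑ xs (λ x → ∑ ys (f x)) ≡ ∑ ys (λ y → ∑ xs (λ x → f x y))
∑-swap []       ys f = sym (∑-zero ys)
∑-swap (x ∷ xs) ys f =
  trans (cong (∑ ys (f x) +_) (∑-swap xs ys f)) (sym (∑-+ ys (f x) (λ y → ∑ xs (λ x′ → f x′ y))))

------------------------------------------------------------------------
-- Enumerations are complete and without repetition

module _ {A : Set} where

  vecs-complete : {xs : List A} → (∀ x → x ∈ₗ xs) → ∀ {n} (v : Vec A n) → v ∈ₗ vecs xs n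
  vecs-complete h []      = here refl
  vecs-complete h (x ∷ v) = ∈-cartesianProductWith⁺ _∷_ (h x) (vecs-complete h v)

  vecs-unique : {xs : List A} → Unique xs → ∀ n → Unique (vecs xs n)
  vecs-unique u zero    = [] ∷ []
  vecs-unique u (suc n) = Unique.cartesianProductWith⁺ _∷_ Vec.∷-injective u (vecs-unique u n)

  pigeonhole : (xs : List A) → (∀ x → x ∈ₗ xs) → (f : ℕ → A) →
               ∃₂ λ i j → i ℕ.< j × j ℕ.≤ length xs × f i ≡ f j
  pigeonhole xs h f
    with i , j , i<j , eq ← Fin.pigeonhole (ℕ.n<1+n (length xs)) (λ i → index (h (f (toℕ i))))
    = toℕ i , toℕ j , i<j , ℕ.≤-pred (Fin.toℕ<n j) ,
      trans (Any.lookup-index (h (f (toℕ i))))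
        (trans (cong (Data.List.lookup xs) eq) (sym (Any.lookup-index (h (f (toℕ j))))))

  listsUpTo : List A → ℕ → List (List A)
  listsUpTo xs zero    = [] ∷ []
  listsUpTo xs (suc l) = [] ∷ cartesianProductWith _∷_ xs (listsUpTo xs l)

  listsUpTo-complete : {xs : List A} → (∀ x → x ∈ₗ xs) →
                       ∀ l p → length p ℕ.≤ l → p ∈ₗ listsUpTo xs l
  listsUpTo-complete h zero    []      _         = here refl
  listsUpTo-complete h (suc l) []      _         = here refl
  listsUpTo-complete h (suc l) (x ∷ p) (s≤s len) =
    there (∈-cartesianProductWith⁺ _∷_ (h x) (listsUpTo-complete h l p len))

bool-complete : ∀ b → b ∈ₗ (true ∷ false ∷ [])
bool-complete true  = here refl
bool-complete false = there (here refl)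

labels-complete : ∀ {n} (c : Label n) → c ∈ₗ labels n
labels-complete = vecs-complete bool-complete

labels-unique : ∀ n → Unique (labels n)
labels-unique = vecs-unique (((λ ()) ∷ []) ∷ [] ∷ [])

module _ (n k : ℕ) where

  steps : List (Label n × Fin k)
  steps = cartesianProduct (labels n) (allFin k)

  steps-complete : ∀ x → x ∈ₗ steps
  steps-complete (c , s) = ∈-cartesianProduct⁺ (labels-complete c) (∈-allFin s)

  steps-unique : Unique steps
  steps-unique = Unique.cartesianProduct⁺ (labels-unique n) (Unique.allFin⁺ k)

  triples : List (Triple n k)
  triples = cartesianProduct (allFin k) steps

  triples-complete : ∀ x → x ∈ₗ triples
  triples-complete (s , x) = ∈-cartesianProduct⁺ (∈-allFin s) (steps-complete x)

------------------------------------------------------------------------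
-- Prefixes

module _ {A : Set} where

  ⊑-refl : ∀ (p : List A) → p ⊑ p
  ⊑-refl []      = []
  ⊑-refl (x ∷ p) = refl ∷ ⊑-refl p

  ⊑-trans : ∀ {p q r : List A} → p ⊑ q → q ⊑ r → p ⊑ r
  ⊑-trans []         _          = []
  ⊑-trans (refl ∷ h) (refl ∷ g) = refl ∷ ⊑-trans h g

  ⊑-length : ∀ {p q : List A} → p ⊑ q → length p ℕ.≤ length q
  ⊑-length []      = z≤n
  ⊑-length (_ ∷ h) = s≤s (⊑-length h)

  ⊑-++ : ∀ (p q : List A) → p ⊑ (p ++ q)
  ⊑-++ []      q = []
  ⊑-++ (x ∷ p) q = refl ∷ ⊑-++ p q

  ⊑-∷ʳ : ∀ {p q : List A} {x} → p ⊑ (q ∷ʳ x) → p ≢ q ∷ʳ x → p ⊑ q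
  ⊑-∷ʳ {[]}                  h        ne = []
  ⊑-∷ʳ {y ∷ []}    {[]}    (refl ∷ h) ne = ⊥-elim (ne refl)
  ⊑-∷ʳ {y ∷ z ∷ p} {[]}    (_ ∷ ())   ne
  ⊑-∷ʳ {y ∷ p}     {z ∷ q} (refl ∷ h) ne = refl ∷ ⊑-∷ʳ h (ne ∘ cong (y ∷_))

  -- A strict prefix extends by one element.

  ⊑-next : ∀ {p q : List A} → p ⊑ q → p ≢ q → ∃ λ x → (p ∷ʳ x) ⊑ q
  ⊑-next {[]} {[]}    []         ne = ⊥-elim (ne refl)
  ⊑-next {[]} {x ∷ q} []         ne = x , refl ∷ []
  ⊑-next {x ∷ p}      (refl ∷ h) ne with y , g ← ⊑-next h (ne ∘ cong (x ∷_)) = y , refl ∷ g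

  ∷ʳ-⊑-injective : ∀ {p q : List A} {x y} → (p ∷ʳ x) ⊑ q → (p ∷ʳ y) ⊑ q → x ≡ y
  ∷ʳ-⊑-injective {[]}    (refl ∷ _) (refl ∷ _) = refl
  ∷ʳ-⊑-injective {_ ∷ p} (_ ∷ h)    (_ ∷ g)    = ∷ʳ-⊑-injective {p} h g

  applyUpTo-⊑ : ∀ (ω : ℕ → A) {i j} → i ℕ.≤ j → applyUpTo ω i ⊑ applyUpTo ω j
  applyUpTo-⊑ ω z≤n     = []
  applyUpTo-⊑ ω (s≤s h) = refl ∷ applyUpTo-⊑ (ω ∘ suc) h

  applyUpTo-≢ : ∀ (ω : ℕ → A) {i j} → i ℕ.< j → applyUpTo ω i ≢ applyUpTo ω j
  applyUpTo-≢ ω {i} {j} i<j eq = ℕ.<-irrefl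
    (trans (sym (List.length-applyUpTo ω i)) (trans (cong length eq) (List.length-applyUpTo ω j))) i<j

------------------------------------------------------------------------
-- The effect of a word on the automaton: where it leads and what it visits

module _ {n m : ℕ} (A : DRA n m) where
  open DRA A
  open ≡-Reasoning

  visits : Fin m → List (Label n) → Subset m
  visits q []      = ∅
  visits q (c ∷ t) = ⁅ Δ q c ⁆ ∪ visits (Δ q c) t

  visits⁺ : ∀ q {t′ t} → t′ ≢ [] → t′ ⊑ t → Δ* q t′ ∈ visits q t
  visits⁺ q {[]}                  ne h          = ⊥-elim (ne refl)
  visits⁺ q {c ∷ []}     {_ ∷ t} ne (refl ∷ h) = x∈p∪q⁺ (inj₁ (x∈⁅x⁆ _))
  visits⁺ q {c ∷ d ∷ t′} {_ ∷ t} ne (refl ∷ h) = x∈p∪q⁺ (inj₂ (visits⁺ (Δ q c) (λ ()) h))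

  visits⁻ : ∀ q t {x} → x ∈ visits q t → ∃ λ t′ → t′ ≢ [] × t′ ⊑ t × Δ* q t′ ≡ x
  visits⁻ q []      x∈ = ⊥-elim (∉⊥ x∈)
  visits⁻ q (c ∷ t) x∈ with x∈p∪q⁻ ⁅ Δ q c ⁆ (visits (Δ q c) t) x∈
  ... | inj₁ h = [ c ] , (λ ()) , refl ∷ [] , sym (x∈⁅y⁆⇒x≡y (Δ q c) h)
  ... | inj₂ h with t′ , _ , pre , eq ← visits⁻ (Δ q c) t h = c ∷ t′ , (λ ()) , refl ∷ pre , eq

  Δ*-∷ʳ : ∀ q t c → Δ* q (t ∷ʳ c) ≡ Δ (Δ* q t) c
  Δ*-∷ʳ q []      c = refl
  Δ*-∷ʳ q (d ∷ t) c = Δ*-∷ʳ (Δ q d) t c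

  visits-∷ʳ : ∀ q t c → visits q (t ∷ʳ c) ≡ visits q t ∪ ⁅ Δ (Δ* q t) c ⁆
  visits-∷ʳ q []      c = trans (∪-identityʳ ⁅ Δ q c ⁆) (sym (∪-identityˡ ⁅ Δ q c ⁆))
  visits-∷ʳ q (d ∷ t) c =
    trans (cong (⁅ Δ q d ⁆ ∪_) (visits-∷ʳ (Δ q d) t c)) (sym (∪-assoc ⁅ Δ q d ⁆ _ _))

  Effect : Set
  Effect = Vec (Fin m × Subset m) m

  effect : List (Label n) → Effect
  effect t = tabulate (λ q → Δ* q t , visits q t)

  effects : List Effect
  effects = vecs (cartesianProduct (allFin m) (labels m)) m

  effects-complete : ∀ x → x ∈ₗ effects
  effects-complete =
    vecs-complete (λ (q , X) → ∈-cartesianProduct⁺ (∈-allFin q) (labels-complete X))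

  SameEffect : List (Label n) → List (Label n) → Set
  SameEffect t u = ∀ q → Δ* q t ≡ Δ* q u × visits q t ≡ visits q u

  effect-≡ : ∀ t u → effect t ≡ effect u → SameEffect t u
  effect-≡ t u eq q = cong proj₁ eq′ , cong proj₂ eq′
    where
    eq′ : (Δ* q t , visits q t) ≡ (Δ* q u , visits q u)
    eq′ = trans (sym (Vec.lookup∘tabulate _ q))
            (trans (cong (λ v → lookup v q) eq) (Vec.lookup∘tabulate _ q))

  sameEffect-∷ʳ : ∀ t u c → SameEffect t u → SameEffect (t ∷ʳ c) (u ∷ʳ c)
  sameEffect-∷ʳ t u c h q =
    trans (Δ*-∷ʳ q t c) (trans (cong (λ x → Δ x c) (proj₁ (h q))) (sym (Δ*-∷ʳ q u c))) ,
    trans (visits-∷ʳ q t c)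
      (trans (cong₂ (λ x y → y ∪ ⁅ Δ x c ⁆) (proj₁ (h q)) (proj₂ (h q))) (sym (visits-∷ʳ q u c)))

  Preserves : List (Label n) → Set
  Preserves t = ∀ q x → x ∈ visits q t → ∀ i →
    (x ∈ L i → Δ* q t ∈ L i) × (x ∈ U i → Δ* q t ∈ U i)

  preserves? : ∀ t → Dec (Preserves t)
  preserves? t = Fin.all? λ q → Fin.all? λ x → x ∈? visits q t →-dec Fin.all? λ i →
    (x ∈? L i →-dec Δ* q t ∈? L i) ×-dec (x ∈? U i →-dec Δ* q t ∈? U i)

  fromPreserves : ∀ {t} → t ≢ [] → Preserves t → AcceptancePreserving A t
  fromPreserves ne h = ne , λ q t′ ne′ pre → h q (Δ* q t′) (visits⁺ q ne′ pre)

  toPreserves : ∀ {t} → AcceptancePreserving A t → Preserves t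
  toPreserves {t} (_ , h) q x x∈ i with t′ , ne , pre , refl ← visits⁻ q t x∈ = h q t′ ne pre i

  acceptancePreserving? : ∀ t → Dec (AcceptancePreserving A t)
  acceptancePreserving? []      = no λ h → proj₁ h refl
  acceptancePreserving? (c ∷ t) = map′ (fromPreserves (λ ())) toPreserves (preserves? (c ∷ t))

  ∼-dec : ∀ t u → Dec (_∼_ A t u)
  ∼-dec t u = acceptancePreserving? t ×-dec acceptancePreserving? u ×-dec
    Fin.all? λ q → Δ* q t Fin.≟ Δ* q u

  single-preserving : ∀ c → AcceptancePreserving A [ c ]
  single-preserving c = (λ ()) , single
    where
    single : ∀ q t′ → t′ ≢ [] → t′ ⊑ [ c ] → ∀ i →
      (Δ* q t′ ∈ L i → Δ q c ∈ L i) × (Δ* q t′ ∈ U i → Δ q c ∈ U i)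
    single q []          ne h           i = ⊥-elim (ne refl)
    single q (d ∷ [])    ne (refl ∷ []) i = (λ x → x) , (λ x → x)
    single q (d ∷ _ ∷ _) ne (_ ∷ ())    i

  Good : List (Label n) → Set
  Good t = ∃ λ c → _∼_ A t [ c ]

  good-single : ∀ c → Good [ c ]
  good-single c = c , single-preserving c , single-preserving c , λ _ → refl

  good-transfer : ∀ t u → u ≢ [] → SameEffect t u → Good t → Good u
  good-transfer t u ne h (c , ap , ap′ , eq) =
    c , fromPreserves ne pres , ap′ , λ q → trans (sym (proj₁ (h q))) (eq q)
    where
    pres : Preserves u
    pres q x x∈ i with toPreserves ap q x (subst (x ∈_) (sym (proj₂ (h q))) x∈) i
    ... | f , g = subst (_∈ L i) (proj₁ (h q)) ∘ f , subst (_∈ U i) (proj₁ (h q)) ∘ g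

------------------------------------------------------------------------
-- Every path extends to an infinite path

module _ {n k : ℕ} (M : MC n k) where
  open MC M

  successor : ∀ s → ∃ λ x → IsEdge M x × src x ≡ s
  successor s with Any.any? (λ (c , s′) → 0ℚ ℚ.<? δ s c s′) (steps n k)
  ... | yes h with (c , s′) , h′ ← Any.satisfied h = (s , c , s′) , h′ , refl
  ... | no ¬h = contradiction (trans (sym (∑δ≡1 s)) (trans (∑-cong (steps n k) zeros) (∑-zero (steps n k)))) λ ()
    where
    zeros : ∀ x → x ∈ₗ steps n k → δ s (proj₁ x) (proj₂ x) ≡ 0ℚ
    zeros (c , s′) x∈ =
      ℚ.≤-antisym (ℚ.≮⇒≥ λ pos → ¬h (Any.map (λ { refl → pos }) x∈)) (0≤δ s c s′)

  extend : Triple n k → List (Triple n k) → ℕ → Triple n k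
  extend x p       zero    = x
  extend x []      (suc i) = extend (proj₁ (successor (tgt x))) [] i
  extend x (y ∷ p) (suc i) = extend y p i

  extend-infPath : ∀ x p → IsPath M (x ∷ p) → IsInfPath M (extend x p)
  extend-infPath x []      (ex ∷ _ , _)       zero    = ex , sym (proj₂ (proj₂ (successor (tgt x))))
  extend-infPath x (y ∷ p) (ex ∷ _ , xy ∷ _)  zero    = ex , xy
  extend-infPath x []      _                  (suc i) =
    extend-infPath _ [] (proj₁ (proj₂ (successor (tgt x))) ∷ [] , [-]) i
  extend-infPath x (y ∷ p) (_ ∷ es , _ ∷ lk)  (suc i) = extend-infPath y p (es , lk) i

  extend-prefix : ∀ x p → applyUpTo (extend x p) (length (x ∷ p)) ≡ x ∷ p
  extend-prefix x []      = refl
  extend-prefix x (y ∷ p) = cong (x ∷_) (extend-prefix y p)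

  isPath? : ∀ p → Dec (IsPath M p)
  isPath? p = All.all? (λ _ → 0ℚ ℚ.<? _) p ×-dec linked? (λ x y → tgt x Fin.≟ src y) p

  infPath-prefix : ∀ ω → IsInfPath M ω → ∀ i → IsPath M (applyUpTo ω i)
  infPath-prefix ω h i = edges ω h i , links ω h i
    where
    edges : ∀ ω → IsInfPath M ω → ∀ i → All (IsEdge M) (applyUpTo ω i)
    edges ω h zero    = []
    edges ω h (suc i) = proj₁ (h 0) ∷ edges (ω ∘ suc) (h ∘ suc) i

    links : ∀ ω → IsInfPath M ω → ∀ i → Linked (λ x y → tgt x ≡ src y) (applyUpTo ω i)
    links ω h zero          = []
    links ω h (suc zero)    = [-]
    links ω h (suc (suc i)) = proj₂ (h 0) ∷ links (ω ∘ suc) (h ∘ suc) (suc i)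

------------------------------------------------------------------------
-- MCCS is finite: a long path avoiding it could be pumped to an infinite
-- path avoiding it.  Hence the sums over T(c,s) are finite sums.

module _ {n k m : ℕ} (M : MC n k) (A : DRA n m) (e : Triple n k)
         {T : List (Triple n k) → Set} (isT : IsMCCS M A e T) where
  open IsMCCS isT

  mccs-good : ∀ {p} → T p → Good A (trace p)
  mccs-good h = proj₂ (simulated h)

  -- Two elements of T lying on the same infinite path are equal.

  mccs-unique : ∀ (ω : ℕ → Triple n k) i j → T (applyUpTo ω i) → T (applyUpTo ω j) → i ≡ j
  mccs-unique ω i j Ti Tj with ℕ.<-cmp i j
  ... | tri≈ _ eq _ = eq
  ... | tri< lt _ _ with c , sim ← mccs-good Ti =
    ⊥-elim (minimal Tj _ (applyUpTo-⊑ ω (ℕ.<⇒≤ lt)) (applyUpTo-≢ ω lt)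
             (λ eq → e∉T (subst T eq Ti)) c sim)
  ... | tri> _ _ gt with c , sim ← mccs-good Tj =
    ⊥-elim (minimal Ti _ (applyUpTo-⊑ ω (ℕ.<⇒≤ gt)) (applyUpTo-≢ ω gt)
             (λ eq → e∉T (subst T eq Tj)) c sim)

  configurations : List (Fin k × Effect A)
  configurations = cartesianProduct (allFin k) (effects A)

  configurations-complete : ∀ x → x ∈ₗ configurations
  configurations-complete (s , v) = ∈-cartesianProduct⁺ (∈-allFin s) (effects-complete A v)

  bound : ℕ
  bound = suc (length configurations)

  module _ (ω : ℕ → Triple n k) (path : IsInfPath M ω) (start : ω 0 ≡ e) where

    word : (ℕ → Triple n k) → ℕ → List (Label n)
    word ω i = trace (applyUpTo ω i)

    word-suc : ∀ ω i → word ω (suc i) ≡ word ω i ∷ʳ label (ω i)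
    word-suc ω i = trans (cong trace (sym (List.applyUpTo-∷ʳ ω i))) (List.map-++ label (applyUpTo ω i) _)

    module Loop (i j : ℕ) (2≤i : 2 ℕ.≤ i) (i<j : i ℕ.< j) (sameState : src (ω i) ≡ src (ω j))
                (sameEffect : SameEffect A (word ω j) (word ω i)) where

      wrap : ∀ {l} → Dec (l ≡ j) → ℕ
      wrap     (yes _) = i
      wrap {l} (no  _) = l

      pos : ℕ → ℕ
      pos zero    = zero
      pos (suc l) = wrap (suc (pos l) ℕ.≟ j)

      loop : ℕ → Triple n k
      loop = ω ∘ pos

      wrap-src : ∀ {l} (d : Dec (l ≡ j)) → src (ω (wrap d)) ≡ src (ω l)
      wrap-src (yes refl) = sameState
      wrap-src (no _)     = refl

      wrap-effect : ∀ {l} (d : Dec (l ≡ j)) → SameEffect A (word ω l) (word ω (wrap d))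
      wrap-effect (yes refl) = sameEffect
      wrap-effect (no _) q   = refl , refl

      wrap-<j : ∀ {l} (d : Dec (l ≡ j)) → l ℕ.≤ j → wrap d ℕ.< j
      wrap-<j (yes _) h = i<j
      wrap-<j (no ne) h = ℕ.≤∧≢⇒< h ne

      wrap-≥ : ∀ {l l′} (d : Dec (l ≡ j)) → l′ ℕ.≤ 2 → l′ ℕ.≤ l → l′ ℕ.≤ wrap d
      wrap-≥ (yes _) h h′ = ℕ.≤-trans h 2≤i
      wrap-≥ (no _)  h h′ = h′

      pos-<j : ∀ l → pos l ℕ.< j
      pos-<j zero    = ℕ.≤-<-trans z≤n i<j
      pos-<j (suc l) = wrap-<j (suc (pos l) ℕ.≟ j) (pos-<j l)

      pos-≥1 : ∀ l → 1 ℕ.≤ pos (suc l)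
      pos-≥1 l = wrap-≥ (suc (pos l) ℕ.≟ j) (s≤s z≤n) (s≤s z≤n)

      pos-≥2 : ∀ l → 2 ℕ.≤ pos (suc (suc l))
      pos-≥2 l = wrap-≥ (suc (pos (suc l)) ℕ.≟ j) ℕ.≤-refl (s≤s (pos-≥1 l))

      loop-path : IsInfPath M loop
      loop-path l = proj₁ (path (pos l)) ,
        trans (proj₂ (path (pos l))) (sym (wrap-src (suc (pos l) ℕ.≟ j)))

      loop-effect : ∀ l → SameEffect A (word loop l) (word ω (pos l))
      loop-effect zero    q = refl , refl
      loop-effect (suc l) q =
        trans (cong (λ t → Δ* q t) (word-suc loop l)) (trans (proj₁ step) (proj₁ wrapped)) ,
        trans (cong (visits A q) (word-suc loop l)) (trans (proj₂ step) (proj₂ wrapped))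
        where
        open DRA A
        step : Δ* q (word loop l ∷ʳ label (loop l)) ≡ Δ* q (word ω (suc (pos l))) ×
               visits A q (word loop l ∷ʳ label (loop l)) ≡ visits A q (word ω (suc (pos l)))
        step = subst (λ t → Δ* q (word loop l ∷ʳ label (loop l)) ≡ Δ* q t ×
                            visits A q (word loop l ∷ʳ label (loop l)) ≡ visits A q t)
                 (sym (word-suc ω (pos l)))
                 (sameEffect-∷ʳ A (word loop l) (word ω (pos l)) (label (loop l)) (loop-effect l) q)
        wrapped : Δ* q (word ω (suc (pos l))) ≡ Δ* q (word ω (pos (suc l))) ×
                  visits A q (word ω (suc (pos l))) ≡ visits A q (word ω (pos (suc l)))
        wrapped = wrap-effect (suc (pos l) ℕ.≟ j) q

      word-nonempty : ∀ {l} → 2 ℕ.≤ l → word ω l ≢ []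
      word-nonempty (s≤s _) ()

      find : ∃ λ l → 2 ℕ.≤ l × l ℕ.< j × Good A (word ω l)
      find with exhaust loop loop-path start
      ... | zero        , h with () ← proj₂ (paths h)
      ... | suc zero    , h = ⊥-elim (e∉T (subst (λ x → T [ x ]) start h))
      ... | suc (suc l) , h = pos (suc (suc l)) , pos-≥2 l , pos-<j (suc (suc l)) ,
        good-transfer A (word loop (suc (suc l))) _ (word-nonempty (pos-≥2 l)) (loop-effect (suc (suc l))) (mccs-good h)

    good-prefix : ∃ λ l → 2 ℕ.≤ l × l ℕ.≤ bound × Good A (word ω l)
    good-prefix
      with pigeonhole configurations configurations-complete
             (λ l → src (ω (suc l)) , effect A (word ω (suc l)))
    ... | zero  , suc j , _   , j≤ , eq = suc (suc j) , s≤s (s≤s z≤n) , s≤s j≤ ,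
      good-transfer A (word ω 1) (word ω (suc (suc j))) (λ ()) (effect-≡ A (word ω 1) (word ω (suc (suc j))) (cong proj₂ eq)) (good-single A (label (ω 0)))
    ... | suc i , j     , i<j , j≤ , eq =
      let l , 2≤l , l<j , g = Loop.find (suc (suc i)) (suc j) (s≤s (s≤s z≤n)) (s≤s i<j)
                                (cong proj₁ eq) (effect-≡ A (word ω (suc j)) (word ω (suc (suc i))) (sym (cong proj₂ eq)))
      in l , 2≤l , ℕ.<⇒≤ (ℕ.<-≤-trans l<j (s≤s j≤)) , g

  mccs-length : ∀ {p} → T p → length p ℕ.≤ bound
  mccs-length {[]}    Tp = z≤n
  mccs-length {x ∷ p} Tp with refl ∷ _ ← proj₂ (paths Tp) = helper (good-prefix ω ωpath refl)
    where
    ω : ℕ → Triple n k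
    ω = extend M e p
    ωpath : IsInfPath M ω
    ωpath = extend-infPath M e p (proj₁ (paths Tp))
    helper : (∃ λ l → 2 ℕ.≤ l × l ℕ.≤ bound × Good A (trace (applyUpTo ω l))) →
             length (e ∷ p) ℕ.≤ bound
    helper (l , 2≤l , l≤ , c , sim) with length (e ∷ p) ℕ.≤? l
    ... | yes h = ℕ.≤-trans h l≤
    ... | no ¬h = ⊥-elim (minimal Tp (applyUpTo ω l)
        (subst (applyUpTo ω l ⊑_) (extend-prefix M e p) (applyUpTo-⊑ ω (ℕ.<⇒≤ (ℕ.≰⇒> ¬h))))
        (λ eq → applyUpTo-≢ ω (ℕ.≰⇒> ¬h) (trans eq (sym (extend-prefix M e p))))
        (λ eq → ℕ.<-irrefl (trans (cong length (sym eq)) (List.length-applyUpTo ω l)) 2≤l)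
        c sim)

  mccs? : ∀ p → Dec (T p)
  mccs? [] = no λ Tp → case-[] (proj₂ (paths Tp))
    where
    case-[] : ¬ ([ e ] ⊑ [])
    case-[] ()
  mccs? (x ∷ p) with x ≟ₜ e | isPath? M (x ∷ p)
  ... | no ne    | _      = no λ Tp → case-≢ (proj₂ (paths Tp))
    where
    case-≢ : ¬ ([ e ] ⊑ (x ∷ p))
    case-≢ (eq ∷ _) = ne (sym eq)
  ... | yes _    | no ¬pa = no λ Tp → ¬pa (proj₁ (paths Tp))
  ... | yes refl | yes pa with exhaust (extend M x p) (extend-infPath M x p pa) refl
  ...   | i , Ti with i ℕ.≟ length (x ∷ p)
  ...     | yes eq = yes (subst T (trans (cong (applyUpTo (extend M x p)) eq) (extend-prefix M x p)) Ti)
  ...     | no ne  = no λ Tp → ne (mccs-unique (extend M x p) i (length (x ∷ p)) Ti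
                                     (subst T (sym (extend-prefix M x p)) Tp))

  _≟ₚ_ : DecidableEquality (List (Triple n k))
  _≟ₚ_ = List.≡-dec _≟ₜ_

  mccsList : List (List (Triple n k))
  mccsList = deduplicate _≟ₚ_ (filter mccs? (listsUpTo (triples n k) bound))

  mccsList-unique : Unique mccsList
  mccsList-unique = DecUnique.deduplicate-! _≟ₚ_ _

  mccsList-⇔ : ∀ p → p ∈ₗ mccsList ⇔ T p
  mccsList-⇔ p = mk⇔
    (λ p∈ → proj₂ (∈-filter⁻ mccs? {xs = listsUpTo (triples n k) bound} (∈-deduplicate⁻ _≟ₚ_ _ p∈)))
    (λ Tp → ∈-deduplicate⁺ _≟ₚ_ (∈-filter⁺ mccs?
              (listsUpTo-complete (triples-complete n k) bound p (mccs-length Tp)) Tp))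

  -- ∑ { ℙ p | p ∈ T , O(p) ∼ c , last(p) = s }

  inT? : ∀ c s (p : List (Triple n k)) → Dec (_∼_ A (trace p) [ c ] × lastState p ≡ just s)
  inT? c s p = ∼-dec A (trace p) [ c ] ×-dec Maybe.≡-dec Fin._≟_ (lastState p) (just s)

  mass : Label n → Fin k → ℚ
  mass c s = ∑ (filter (inT? c s) mccsList) (ℙ M)

------------------------------------------------------------------------
-- The probabilities of the elements of MCCS sum up to that of the edge

module _ {n k : ℕ} where

  lastState-∷ʳ : ∀ (p : List (Triple n k)) x → lastState (p ∷ʳ x) ≡ just (tgt x)
  lastState-∷ʳ []          x = refl
  lastState-∷ʳ (y ∷ [])    x = refl
  lastState-∷ʳ (y ∷ z ∷ p) x = lastState-∷ʳ (z ∷ p) x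

  lastState-∷ : ∀ x (p : List (Triple n k)) → ∃ λ s → lastState (x ∷ p) ≡ just s
  lastState-∷ x []      = tgt x , refl
  lastState-∷ x (y ∷ p) = lastState-∷ y p

  last-occurs : ∀ x (p : List (Triple n k)) {s} → lastState (x ∷ p) ≡ just s →
                1 ℕ.≤ length (filter (Fin._≟ s) (map tgt (x ∷ p)))
  last-occurs x [] refl with tgt x Fin.≟ tgt x
  ... | yes _ = s≤s z≤n
  ... | no ne = contradiction refl ne
  last-occurs x (y ∷ p) {s} eq with tgt x Fin.≟ s
  ... | yes _ = s≤s z≤n
  ... | no _  = last-occurs y p eq

module _ {n k : ℕ} (M : MC n k) where
  open MC M

  Links : List (Triple n k) → Set
  Links = Linked (λ x y → tgt x ≡ src y)

  links-∷ʳ : ∀ p {s} x → Links p → lastState p ≡ just s → src x ≡ s → Links (p ∷ʳ x)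
  links-∷ʳ []          x _          _    _  = [-]
  links-∷ʳ (y ∷ [])    x _          refl eq = sym eq ∷ [-]
  links-∷ʳ (y ∷ z ∷ p) x (yz ∷ lk)  ls   eq = yz ∷ links-∷ʳ (z ∷ p) x lk ls eq

  isPath-∷ʳ : ∀ p {s} x → IsPath M p → lastState p ≡ just s → src x ≡ s → IsEdge M x →
              IsPath M (p ∷ʳ x)
  isPath-∷ʳ p x (es , lk) ls eq ex = edges-∷ʳ es , links-∷ʳ p x lk ls eq
    where
    edges-∷ʳ : ∀ {p} → All (IsEdge M) p → All (IsEdge M) (p ∷ʳ x)
    edges-∷ʳ []       = ex ∷ []
    edges-∷ʳ (h ∷ hs) = h ∷ edges-∷ʳ hs

  next-src : ∀ {p t s x} → Links t → (p ∷ʳ x) ⊑ t → lastState p ≡ just s → src x ≡ s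
  next-src {y ∷ []}    (yx ∷ _)  (refl ∷ refl ∷ _) refl = sym yx
  next-src {y ∷ z ∷ p} (_ ∷ lk)  (refl ∷ h)        ls   = next-src {z ∷ p} lk h ls
  next-src {[]} _ _ ()

  next-edge : ∀ {p t x} → All (IsEdge M) t → (p ∷ʳ x) ⊑ t → IsEdge M x
  next-edge {[]}    (ex ∷ _) (refl ∷ _) = ex
  next-edge {_ ∷ p} (_ ∷ es) (_ ∷ h)    = next-edge {p} es h

  ℙ-∷ʳ : ∀ p x → ℙ M (p ∷ʳ x) ≡ ℙ M p * δ (src x) (label x) (tgt x)
  ℙ-∷ʳ []      x = trans (ℚ.*-identityʳ (δ (src x) (label x) (tgt x))) (sym (ℚ.*-identityˡ (δ (src x) (label x) (tgt x))))
  ℙ-∷ʳ (y ∷ p) x = trans (cong (δ (src y) (label y) (tgt y) *_) (ℙ-∷ʳ p x)) (sym (ℚ.*-assoc (δ (src y) (label y) (tgt y)) (ℙ M p) _))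

  0≤ℙ : ∀ p → 0ℚ ≤ ℙ M p
  0≤ℙ []                = ℚ.nonNegative⁻¹ 1ℚ
  0≤ℙ ((s , c , s′) ∷ p) = ℚ.nonNegative⁻¹ _
    where instance
      prod = ℚ.nonNeg*nonNeg⇒nonNeg (δ s c s′) {{Data.Rational.nonNegative (0≤δ s c s′)}}
               (ℙ M p) {{Data.Rational.nonNegative (0≤ℙ p)}}

module _ {n k m : ℕ} (M : MC n k) (A : DRA n m) (e : Triple n k)
         {T : List (Triple n k) → Set} (isT : IsMCCS M A e T) where
  open MC M
  open IsMCCS isT
  open ≡-Reasoning

  private
    paths-in : List (List (Triple n k))
    paths-in = mccsList M A e isT

    ∈⇒T : ∀ {p} → p ∈ₗ paths-in → T p
    ∈⇒T {p} = Equivalence.to (mccsList-⇔ M A e isT p)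

    T⇒∈ : ∀ {p} → T p → p ∈ₗ paths-in
    T⇒∈ {p} = Equivalence.from (mccsList-⇔ M A e isT p)

  _⊑?_ : (p t : List (Triple n k)) → Dec (p ⊑ t)
  _⊑?_ = prefix? _≟ₜ_

  massBelow : List (Triple n k) → ℚ
  massBelow p = ∑ paths-in (λ t → when (p ⊑? t) (ℙ M t))

  massBelow≡ℙ : ∀ fuel p → IsPath M (e ∷ p) →
                (∀ p′ → p′ ⊑ (e ∷ p) → p′ ≢ e ∷ p → ¬ T p′) →
                suc (bound M A e isT) ℕ.≤ fuel ℕ.+ length (e ∷ p) →
                massBelow (e ∷ p) ≡ ℙ M (e ∷ p)
  massBelow≡ℙ fuel p path strict len with mccs? M A e isT (e ∷ p)
  massBelow≡ℙ fuel p path strict len | yes Tp =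
    trans (∑-single paths-in _ (mccsList-unique M A e isT) (T⇒∈ Tp) others)
          (when-yes ((e ∷ p) ⊑? (e ∷ p)) (⊑-refl (e ∷ p)))
    where
    others : ∀ t → t ∈ₗ paths-in → t ≢ e ∷ p → when ((e ∷ p) ⊑? t) (ℙ M t) ≡ 0ℚ
    others t t∈ ne = when-no ((e ∷ p) ⊑? t) λ pre →
      let c , sim = mccs-good M A e isT Tp
      in minimal (∈⇒T t∈) (e ∷ p) pre (ne ∘ sym) (λ eq → e∉T (subst T eq Tp)) c sim
  massBelow≡ℙ zero p path strict len | no ¬Tp
    with i , Ti ← exhaust (extend M e p) (extend-infPath M e p path) refl =
    ⊥-elim (strict (applyUpTo ω i)
      (subst (applyUpTo ω i ⊑_) (extend-prefix M e p) (applyUpTo-⊑ ω (ℕ.<⇒≤ i<)))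
      (λ eq → applyUpTo-≢ ω i< (trans eq (sym (extend-prefix M e p)))) Ti)
    where
    ω = extend M e p
    i< : i ℕ.< length (e ∷ p)
    i< = ℕ.≤-trans (s≤s (subst (ℕ._≤ bound M A e isT) (List.length-applyUpTo ω i)
                          (mccs-length M A e isT Ti))) len
  massBelow≡ℙ (suc fuel) p path strict len | no ¬Tp with s , ls ← lastState-∷ e p = begin
    massBelow (e ∷ p)
      ≡⟨ ∑-cong paths-in split ⟩
    ∑ paths-in (λ t → ∑ (steps n k) (λ x → when (((e ∷ p) ∷ʳ (s , x)) ⊑? t) (ℙ M t)))
      ≡⟨ ∑-swap paths-in (steps n k) (λ t x → when (((e ∷ p) ∷ʳ (s , x)) ⊑? t) (ℙ M t)) ⟩
    ∑ (steps n k) (λ x → massBelow ((e ∷ p) ∷ʳ (s , x)))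
      ≡⟨ ∑-cong (steps n k) (λ x _ → below x) ⟩
    ∑ (steps n k) (λ (c , s′) → ℙ M (e ∷ p) * δ s c s′)
      ≡⟨ ∑-*ˡ (steps n k) (ℙ M (e ∷ p)) _ ⟩
    ℙ M (e ∷ p) * ∑ (steps n k) (λ (c , s′) → δ s c s′)
      ≡⟨ cong (ℙ M (e ∷ p) *_) (∑δ≡1 s) ⟩
    ℙ M (e ∷ p) * 1ℚ
      ≡⟨ ℚ.*-identityʳ _ ⟩
    ℙ M (e ∷ p) ∎
    where
    split : ∀ t → t ∈ₗ paths-in → when ((e ∷ p) ⊑? t) (ℙ M t) ≡
            ∑ (steps n k) (λ x → when (((e ∷ p) ∷ʳ (s , x)) ⊑? t) (ℙ M t))
    split t t∈ with (e ∷ p) ⊑? t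
    ... | no ¬pre = sym (trans
      (∑-cong (steps n k) λ x _ → when-no (((e ∷ p) ∷ʳ (s , x)) ⊑? t)
        λ pre → ¬pre (⊑-trans (⊑-++ (e ∷ p) _) pre))
      (∑-zero (steps n k)))
    ... | yes pre with ⊑-next pre (λ eq → ¬Tp (subst T (sym eq) (∈⇒T t∈)))
    ...   | y , preʸ with refl ← next-src M {e ∷ p} (proj₂ (proj₁ (paths (∈⇒T t∈)))) preʸ ls = sym (trans
      (∑-single (steps n k) _ (steps-unique n k) (steps-complete n k (proj₂ y))
        (λ z _ ne → when-no (((e ∷ p) ∷ʳ (s , z)) ⊑? t)
          (λ preᶻ → ne (cong proj₂ (∷ʳ-⊑-injective {p = e ∷ p} preᶻ preʸ)))))
      (when-yes (((e ∷ p) ∷ʳ y) ⊑? t) preʸ))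

    below : ∀ x → massBelow ((e ∷ p) ∷ʳ (s , x)) ≡ ℙ M (e ∷ p) * δ s (proj₁ x) (proj₂ x)
    below x@(c , s′) with 0ℚ ℚ.<? δ s c s′
    ... | yes pos = trans
      (massBelow≡ℙ fuel (p ∷ʳ (s , x)) (isPath-∷ʳ M (e ∷ p) (s , x) path ls refl pos) strict′ len′)
      (ℙ-∷ʳ M (e ∷ p) (s , x))
      where
      strict′ : ∀ p′ → p′ ⊑ (e ∷ p ∷ʳ (s , x)) → p′ ≢ e ∷ p ∷ʳ (s , x) → ¬ T p′
      strict′ p′ pre ne with List.≡-dec _≟ₜ_ p′ (e ∷ p)
      ... | yes refl = ¬Tp
      ... | no ne′   = strict p′ (⊑-∷ʳ {q = e ∷ p} pre ne) ne′
      len′ : suc (bound M A e isT) ℕ.≤ fuel ℕ.+ length (e ∷ p ∷ʳ (s , x))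
      len′ = subst (suc (bound M A e isT) ℕ.≤_)
        (trans (sym (ℕ.+-suc fuel _))
          (cong (λ l → fuel ℕ.+ suc l) (sym (trans (List.length-++ p) (ℕ.+-comm (length p) 1))))) len
    ... | no ¬pos = trans
      (trans (∑-cong paths-in λ t t∈ → when-no (((e ∷ p) ∷ʳ (s , x)) ⊑? t)
               λ pre → ¬pos (next-edge M {e ∷ p} (proj₁ (proj₁ (paths (∈⇒T t∈)))) pre))
             (∑-zero paths-in))
      (sym (trans (cong (ℙ M (e ∷ p) *_) (ℚ.≤-antisym (ℚ.≮⇒≥ ¬pos) (0≤δ s c s′)))
                  (ℚ.*-zeroʳ (ℙ M (e ∷ p)))))

  ∑-mccs : IsEdge M e → ∑ paths-in (ℙ M) ≡ δ (src e) (label e) (tgt e)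
  ∑-mccs edge = begin
    ∑ paths-in (ℙ M)
      ≡⟨ ∑-cong paths-in (λ t t∈ → sym (when-yes ([ e ] ⊑? t) (proj₂ (paths (∈⇒T t∈))))) ⟩
    massBelow [ e ]
      ≡⟨ massBelow≡ℙ (bound M A e isT) [] (edge ∷ [] , [-]) strict
           (ℕ.≤-reflexive (ℕ.+-comm 1 (bound M A e isT))) ⟩
    δ (src e) (label e) (tgt e) * 1ℚ
      ≡⟨ ℚ.*-identityʳ _ ⟩
    δ (src e) (label e) (tgt e) ∎
    where
    strict : ∀ p′ → p′ ⊑ [ e ] → p′ ≢ [ e ] → ¬ T p′
    strict []          _           _  Tp with () ← proj₂ (paths Tp)
    strict (_ ∷ [])    (refl ∷ []) ne Tp = ne refl
    strict (_ ∷ _ ∷ _) (_ ∷ ())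

  ∑-mass : LabelsSeparated A →
           ∑ (steps n k) (λ (c , s) → mass M A e isT c s) ≡ ∑ paths-in (ℙ M)
  ∑-mass separated = begin
    ∑ (steps n k) (λ (c , s) → mass M A e isT c s)
      ≡⟨ ∑-cong (steps n k) (λ (c , s) _ → ∑-filter (inT? M A e isT c s) paths-in (ℙ M)) ⟩
    ∑ (steps n k) (λ (c , s) → ∑ paths-in (λ t → when (inT? M A e isT c s t) (ℙ M t)))
      ≡⟨ ∑-swap (steps n k) paths-in (λ (c , s) t → when (inT? M A e isT c s t) (ℙ M t)) ⟩
    ∑ paths-in (λ t → ∑ (steps n k) (λ (c , s) → when (inT? M A e isT c s t) (ℙ M t)))
      ≡⟨ ∑-cong paths-in (λ t t∈ → once′ t (∈⇒T t∈)) ⟩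
    ∑ paths-in (ℙ M) ∎
    where
    once′ : ∀ t → T t → ∑ (steps n k) (λ (c , s) → when (inT? M A e isT c s t) (ℙ M t)) ≡ ℙ M t
    once′ []      Tt with () ← proj₂ (paths Tt)
    once′ (x ∷ t) Tt with c , sim ← mccs-good M A e isT Tt | s , ls ← lastState-∷ x t =
      trans (∑-single (steps n k) _ (steps-unique n k) (steps-complete n k (c , s))
              (λ (c′ , s′) _ ne → when-no (inT? M A e isT c′ s′ (x ∷ t))
                (λ (sim′ , ls′) → ne (cong₂ _,_ (same sim′ sim) (Maybe.just-injective (trans (sym ls′) ls))))))
            (when-yes (inT? M A e isT c s (x ∷ t)) (sim , ls))
      where
      same : ∀ {c c′} → _∼_ A (trace (x ∷ t)) [ c ] → _∼_ A (trace (x ∷ t)) [ c′ ] → c ≡ c′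
      same {c} {c′} (_ , ap , eq) (_ , ap′ , eq′) =
        separated c c′ (ap , ap′ , λ q → trans (sym (eq q)) (eq′ q))

  -- No element of T ends in the target of e.

  mass-tgt : ∀ c → mass M A e isT c (tgt e) ≡ 0ℚ
  mass-tgt c = begin
    mass M A e isT c (tgt e)
      ≡⟨ ∑-filter (inT? M A e isT c (tgt e)) paths-in (ℙ M) ⟩
    ∑ paths-in (λ t → when (inT? M A e isT c (tgt e) t) (ℙ M t))
      ≡⟨ ∑-cong paths-in (λ t t∈ → when-no (inT? M A e isT c (tgt e) t) (λ (_ , ls) → absurd t (∈⇒T t∈) ls)) ⟩
    ∑ paths-in (λ _ → 0ℚ)
      ≡⟨ ∑-zero paths-in ⟩
    0ℚ ∎
    where
    counted : ∀ y p → lastState (y ∷ p) ≡ just (tgt e) →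
              2 ℕ.≤ length (filter (Fin._≟ tgt e) (tgt e ∷ map tgt (y ∷ p)))
    counted y p ls = subst (2 ℕ.≤_)
      (sym (cong length (List.filter-accept (Fin._≟ tgt e) {tgt e} {map tgt (y ∷ p)} refl)))
      (s≤s (last-occurs y p ls))

    twice : ∀ y p → lastState (y ∷ p) ≡ just (tgt e) → 2 ℕ.≤ occurrences (tgt e) (e ∷ y ∷ p)
    twice y p ls with src e Fin.≟ tgt e
    ... | yes _ = ℕ.m≤n⇒m≤1+n (counted y p ls)
    ... | no _  = counted y p ls

    absurd : ∀ t → T t → lastState t ≢ just (tgt e)
    absurd []          Tt ls with () ← proj₂ (paths Tt)
    absurd (_ ∷ [])    Tt ls with refl ∷ _ ← proj₂ (paths Tt) = e∉T Tt
    absurd (_ ∷ y ∷ p) Tt ls with refl ∷ _ ← proj₂ (paths Tt) = ℕ.<-irrefl (sym (once Tt)) (twice y p ls)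

------------------------------------------------------------------------
-- The replaced Markov chain

module _ {n k m : ℕ} (M : MC n k) (A : DRA n m) (e : Triple n k) (r : Replaceable M A e) where
  open MC M
  open Replaceable r

  δᴿ : Fin k → Label n → Fin k → ℚ
  δᴿ s c s′ =
    if does ((s , c , s′) ≟ₜ e) then 0ℚ
    else if does (s Fin.≟ src e) then δ (src e) c s′ + mass M A e isMCCS c s′
    else δ s c s′

  0≤δᴿ : ∀ s c s′ → 0ℚ ≤ δᴿ s c s′
  0≤δᴿ s c s′ = go ((s , c , s′) ≟ₜ e) (s Fin.≟ src e)
    where
    go : ∀ {P Q : Set} (d : Dec P) (d′ : Dec Q) →
         0ℚ ≤ (if does d then 0ℚ
               else if does d′ then δ (src e) c s′ + mass M A e isMCCS c s′
               else δ s c s′)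
    go (yes _) _       = ℚ.≤-refl
    go (no _)  (no _)  = 0≤δ s c s′
    go (no _)  (yes _) =
      ℚ.+-mono-≤ (0≤δ (src e) c s′) (∑-≥0 (filter (inT? M A e isMCCS c s′) (mccsList M A e isMCCS)) (0≤ℙ M))

  module _ (separated : LabelsSeparated A) (edge : IsEdge M e) where
    open ≡-Reasoning

    row-other : ∀ s → s ≢ src e → ∑ (steps n k) (λ (c , s′) → δᴿ s c s′) ≡ 1ℚ
    row-other s ne = trans (∑-cong (steps n k) (λ (c , s′) _ → unchanged c s′)) (∑δ≡1 s)
      where
      unchanged : ∀ c s′ → δᴿ s c s′ ≡ δ s c s′
      unchanged c s′ = go ((s , c , s′) ≟ₜ e) (s Fin.≟ src e)
        where
        go : ∀ (d : Dec ((s , c , s′) ≡ e)) (d′ : Dec (s ≡ src e)) →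
             (if does d then 0ℚ
              else if does d′ then δ (src e) c s′ + mass M A e isMCCS c s′
              else δ s c s′) ≡ δ s c s′
        go (yes eq) _        = contradiction (cong src eq) ne
        go (no _)   (yes eq) = contradiction eq ne
        go (no _)   (no _)   = refl

    row-src : ∀ s → s ≡ src e → ∑ (steps n k) (λ (c , s′) → δᴿ s c s′) ≡ 1ℚ
    row-src s refl = +-cancelʳ δₑ _ _ (begin
      ∑ (steps n k) (λ (c , s′) → δᴿ s c s′) + δₑ
        ≡⟨ cong (∑ (steps n k) (λ (c , s′) → δᴿ s c s′) +_) (sym removed) ⟩
      ∑ (steps n k) (λ (c , s′) → δᴿ s c s′) + ∑ (steps n k) (λ x → when ((s , x) ≟ₜ e) δₑ)
        ≡⟨ sym (∑-+ (steps n k) (λ (c , s′) → δᴿ s c s′) (λ x → when ((s , x) ≟ₜ e) δₑ)) ⟩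
      ∑ (steps n k) (λ (c , s′) → δᴿ s c s′ + when ((s , c , s′) ≟ₜ e) δₑ)
        ≡⟨ ∑-cong (steps n k) (λ (c , s′) _ → changed c s′) ⟩
      ∑ (steps n k) (λ (c , s′) → δ s c s′ + mass M A e isMCCS c s′)
        ≡⟨ ∑-+ (steps n k) (λ (c , s′) → δ s c s′) (λ (c , s′) → mass M A e isMCCS c s′) ⟩
      ∑ (steps n k) (λ (c , s′) → δ s c s′) + ∑ (steps n k) (λ (c , s′) → mass M A e isMCCS c s′)
        ≡⟨ cong₂ _+_ (∑δ≡1 s) (trans (∑-mass M A e isMCCS separated) (∑-mccs M A e isMCCS edge)) ⟩
      1ℚ + δₑ ∎)
      where
      open GroupProperties ℚ.+-0-group using () renaming (∙-cancelʳ to +-cancelʳ)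

      δₑ : ℚ
      δₑ = δ (src e) (label e) (tgt e)

      removed : ∑ (steps n k) (λ x → when ((s , x) ≟ₜ e) δₑ) ≡ δₑ
      removed = trans
        (∑-single (steps n k) _ (steps-unique n k) (steps-complete n k (proj₂ e))
          (λ x _ ne → when-no ((s , x) ≟ₜ e) (ne ∘ cong proj₂)))
        (when-yes ((s , proj₂ e) ≟ₜ e) refl)

      changed : ∀ c s′ → δᴿ s c s′ + when ((s , c , s′) ≟ₜ e) δₑ ≡ δ s c s′ + mass M A e isMCCS c s′
      changed c s′ = go ((s , c , s′) ≟ₜ e) (s Fin.≟ src e)
        where
        go : ∀ (d : Dec ((s , c , s′) ≡ e)) (d′ : Dec (s ≡ src e)) →
             (if does d then 0ℚ
              else if does d′ then δ (src e) c s′ + mass M A e isMCCS c s′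
              else δ s c s′) + when d δₑ ≡ δ s c s′ + mass M A e isMCCS c s′
        go _          (no ne) = contradiction refl ne
        go (no _)     (yes _) = ℚ.+-identityʳ _
        go (yes refl) (yes _) =
          trans (ℚ.+-comm 0ℚ δₑ) (cong (δₑ +_) (sym (mass-tgt M A e isMCCS c)))

    ∑δᴿ≡1 : ∀ s → ∑ (steps n k) (λ (c , s′) → δᴿ s c s′) ≡ 1ℚ
    ∑δᴿ≡1 s = go (s Fin.≟ src e)
      where
      go : Dec (s ≡ src e) → ∑ (steps n k) (λ (c , s′) → δᴿ s c s′) ≡ 1ℚ
      go (yes eq) = row-src s eq
      go (no ne)  = row-other s ne

    replacedMC : MC n k
    replacedMC = record
      { δ     = δᴿ
      ; 0≤δ   = 0≤δᴿ
      ; δ≤1   = λ s c s′ → subst (δᴿ s c s′ ≤_) (∑δᴿ≡1 s)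
                  (term≤∑ (steps n k) (λ (c , s′) → 0≤δᴿ s c s′) (steps-complete n k (c , s′)))
      ; ∑δ≡1  = ∑δᴿ≡1
      ; sinit = sinit
      }

{-# OPTIONS --safe #-}
module Submission where

-- Cut an infinite path of M into blocks, each either a single edge other than
-- e or an element of MCCS(e, A), and replace every block by one edge carrying
-- the equivalent label.  This gives a path of the replaced chain R with the
-- same acceptance status, since the run on the labels of a block ends in the
-- same position and, at its end, lies in every L_i and U_i met inside it.
-- Conversely an edge of R stands for finitely many blocks, whose
-- probabilities sum up to its own.
--
-- A cover of the accepting paths of R yields one of those of M by replacing
-- each cylinder by its finitely many expansions.  Given a cover C of the
-- accepting paths of M, call a finite path of R of length d settled if each of
-- its expansions extends one of the first d cylinders of C.  By König's lemma
-- every accepting path of R has a settled prefix, and as expansions form a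
-- prefix code, the settled paths of length d have total mass at most that of
-- these d cylinders.  So the shortest settled paths are the required cover.

open import Axiom.ExcludedMiddle using (ExcludedMiddle)
open import Data.Bool using (if_then_else_)
open import Data.Fin using (Fin)
import Data.Fin.Properties as Fin
open import Data.Fin.Subset using (Subset; _∈_)
open import Data.Fin.Subset.Properties using (_∈?_)
open import Data.List
  using (List; []; _∷_; [_]; _++_; _∷ʳ_; length; map; take; filter; concatMap; applyUpTo;
         allFin; cartesianProductWith)
import Data.List.Properties as List
open import Data.List.Membership.Propositional using (find; lose) renaming (_∈_ to _∈ₗ_)
open import Data.List.Membership.Propositional.Properties
  using (∈-++⁺ˡ; ∈-++⁺ʳ; ∈-++⁻; ∈-filter⁺; ∈-filter⁻; ∈-map⁺; ∈-concatMap⁺; ∈-applyUpTo⁺; ∈-allFin;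
         ∈-cartesianProductWith⁺; ∈-cartesianProductWith⁻)
open import Data.List.Relation.Binary.Prefix.Heterogeneous using ([]; _∷_)
open import Data.List.Relation.Binary.Prefix.Heterogeneous.Properties using (prefix?)
open import Data.List.Relation.Unary.All using (All; []; _∷_)
open import Data.List.Relation.Unary.Any using (here; there)
import Data.List.Relation.Unary.Any as Any
open import Data.List.Relation.Unary.Linked using ([-]; _∷_)
import Data.List.Relation.Unary.Linked as Linked
open import Data.Maybe using (Maybe; just; nothing; maybe; _>>=_)
import Data.Maybe.Properties as Maybe
open import Data.Nat using (ℕ; zero; suc; z≤n; s≤s)
import Data.Nat as ℕ
import Data.Nat.Properties as ℕ
open import Data.Product using (∃; ∃₂; Σ-syntax; _×_; _,_; proj₁; proj₂)
open import Data.Rational using (ℚ; 0ℚ; 1ℚ; _+_; _*_; _≤_; _<_)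
import Data.Rational as Rational
import Data.Rational.Properties as ℚ
open import Data.Sum using (_⊎_; inj₁; inj₂)
open import Function using (_∘_; _⇔_; mk⇔; Equivalence)
open import Level using (0ℓ)
open import Relation.Binary.PropositionalEquality
  using (_≡_; _≢_; refl; sym; trans; cong; cong₂; subst; subst₂; module ≡-Reasoning)
open import Relation.Nullary using (¬_; Dec; yes; no; does; contradiction)
open import Relation.Nullary.Decidable using (_×-dec_; ¬?)

open import Defs

-- Finite sums and conditional terms

module _ {A : Set} where

  ∑-mono : ∀ (xs : List A) {f g : A → ℚ} → (∀ x → x ∈ₗ xs → f x ≤ g x) → ∑ xs f ≤ ∑ xs g
  ∑-mono []       h = ℚ.≤-refl
  ∑-mono (x ∷ xs) h = ℚ.+-mono-≤ (h x (here refl)) (∑-mono xs λ y → h y ∘ there)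

  ∑-++ : ∀ (xs ys : List A) (f : A → ℚ) → ∑ (xs ++ ys) f ≡ ∑ xs f + ∑ ys f
  ∑-++ []       ys f = sym (ℚ.+-identityˡ (∑ ys f))
  ∑-++ (x ∷ xs) ys f = trans (cong (f x +_) (∑-++ xs ys f)) (sym (ℚ.+-assoc (f x) (∑ xs f) (∑ ys f)))

module _ {A B : Set} where

  ∑-map : ∀ (h : A → B) (xs : List A) (f : B → ℚ) → ∑ (map h xs) f ≡ ∑ xs (f ∘ h)
  ∑-map h []       f = refl
  ∑-map h (x ∷ xs) f = cong (f (h x) +_) (∑-map h xs f)

  ∑-concatMap : ∀ (h : A → List B) (xs : List A) (f : B → ℚ) →
                ∑ (concatMap h xs) f ≡ ∑ xs (λ x → ∑ (h x) f)
  ∑-concatMap h []       f = refl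
  ∑-concatMap h (x ∷ xs) f =
    trans (∑-++ (h x) (concatMap h xs) f) (cong (∑ (h x) f +_) (∑-concatMap h xs f))

∑-cartesianProductWith : ∀ {A B C : Set} (h : A → B → C) (xs : List A) (ys : List B) (f : C → ℚ) →
  ∑ (cartesianProductWith h xs ys) f ≡ ∑ xs (λ x → ∑ ys (λ y → f (h x y)))
∑-cartesianProductWith h []       ys f = refl
∑-cartesianProductWith h (x ∷ xs) ys f =
  trans (∑-++ (map (h x) ys) (cartesianProductWith h xs ys) f)
    (cong₂ _+_ (∑-map (h x) ys f) (∑-cartesianProductWith h xs ys f))

when-≥0 : {P : Set} (d : Dec P) {v : ℚ} → 0ℚ ≤ v → 0ℚ ≤ when d v
when-≥0 (yes _) h = h
when-≥0 (no _)  _ = ℚ.≤-refl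

when-≤ : {P : Set} (d : Dec P) {v : ℚ} → 0ℚ ≤ v → when d v ≤ v
when-≤ (yes _) _ = ℚ.≤-refl
when-≤ (no _)  h = h

when-0 : {P : Set} (d : Dec P) → when d 0ℚ ≡ 0ℚ
when-0 (yes _) = refl
when-0 (no _)  = refl

when-⇔ : {P Q : Set} (d : Dec P) (d′ : Dec Q) {v : ℚ} → (P → Q) → (Q → P) → when d v ≡ when d′ v
when-⇔ (yes p) d′ f g = sym (when-yes d′ (f p))
when-⇔ (no ¬p) d′ f g = sym (when-no d′ (¬p ∘ g))

when-*ˡ : {P : Set} (d : Dec P) (a v : ℚ) → when d (a * v) ≡ a * when d v
when-*ˡ (yes _) a v = refl
when-*ˡ (no _)  a v = sym (ℚ.*-zeroʳ a)

*-monoˡ-≤₀ : ∀ a {x y} → 0ℚ ≤ a → x ≤ y → a * x ≤ a * y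
*-monoˡ-≤₀ a 0≤a = ℚ.*-monoˡ-≤-nonNeg a {{Rational.nonNegative 0≤a}}

-- Prefixes of lists and of streams

take-applyUpTo : ∀ {A : Set} (ω : ℕ → A) d → take d (applyUpTo ω (suc d)) ≡ applyUpTo ω d
take-applyUpTo ω zero    = refl
take-applyUpTo ω (suc d) = cong (ω 0 ∷_) (take-applyUpTo (ω ∘ suc) d)

take-⊑ : ∀ {A : Set} d (p : List A) → take d p ⊑ p
take-⊑ zero    p       = []
take-⊑ (suc d) []      = []
take-⊑ (suc d) (x ∷ p) = refl ∷ take-⊑ d p

applyUpTo-+ : ∀ {A : Set} (ω : ℕ → A) i j →
  applyUpTo ω (i ℕ.+ j) ≡ applyUpTo ω i ++ applyUpTo (λ l → ω (i ℕ.+ l)) j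
applyUpTo-+ ω zero    j = refl
applyUpTo-+ ω (suc i) j = cong (ω 0 ∷_) (applyUpTo-+ (ω ∘ suc) i j)

applyUpTo-cong : ∀ {A : Set} {ω ω′ : ℕ → A} → (∀ l → ω l ≡ ω′ l) →
                 ∀ j → applyUpTo ω j ≡ applyUpTo ω′ j
applyUpTo-cong h zero    = refl
applyUpTo-cong h (suc j) = cong₂ _∷_ (h 0) (applyUpTo-cong (h ∘ suc) j)

⊑-comparable : ∀ {A : Set} {p q r : List A} → p ⊑ r → q ⊑ r → p ⊑ q ⊎ q ⊑ p
⊑-comparable []         _          = inj₁ []
⊑-comparable (_ ∷ _)    []         = inj₂ []
⊑-comparable (refl ∷ h) (refl ∷ g) with ⊑-comparable h g
... | inj₁ k = inj₁ (refl ∷ k)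
... | inj₂ k = inj₂ (refl ∷ k)

⊑⇒++ : ∀ {A : Set} {p q : List A} → p ⊑ q → ∃ λ r → q ≡ p ++ r
⊑⇒++ {q = q} []         = q , refl
⊑⇒++         (refl ∷ h) with r , refl ← ⊑⇒++ h = r , refl

++-⊑⁺ : ∀ {A : Set} (b : List A) {p q} → p ⊑ q → (b ++ p) ⊑ (b ++ q)
++-⊑⁺ []      h = h
++-⊑⁺ (x ∷ b) h = refl ∷ ++-⊑⁺ b h

++-⊑⁻ : ∀ {A : Set} (b : List A) {p q} → (b ++ p) ⊑ (b ++ q) → p ⊑ q
++-⊑⁻ []      h       = h
++-⊑⁻ (x ∷ b) (_ ∷ h) = ++-⊑⁻ b h

prefix-of-stream : ∀ {A : Set} (ω : ℕ → A) {p} j → length p ℕ.≤ j →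
                   applyUpTo ω (length p) ≡ p → p ⊑ applyUpTo ω j
prefix-of-stream ω j le eq = subst (_⊑ applyUpTo ω j) eq (applyUpTo-⊑ ω le)

-- Enumerating a sequence of finite lists

module _ {A : Set} where

  -- A `nothing` is emitted at every passage to the next list. Each index thus consumes exactly one
  -- step, so the recursion is structural in the index even if many lists are empty.
  flat : List A → (ℕ → List A) → ℕ → Maybe A
  flat (x ∷ xs) lv zero    = just x
  flat (x ∷ xs) lv (suc i) = flat xs lv i
  flat []       lv zero    = nothing
  flat []       lv (suc i) = flat (lv 0) (lv ∘ suc) i

  flat-∈ : ∀ {x} xs lv → x ∈ₗ xs → ∃ λ i → flat xs lv i ≡ just x
  flat-∈ (x ∷ xs) lv (here refl) = 0 , refl
  flat-∈ (x ∷ xs) lv (there x∈) with i , eq ← flat-∈ xs lv x∈ = suc i , eq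

  flat-level : ∀ {x} xs lv d → x ∈ₗ lv d → ∃ λ i → flat xs lv i ≡ just x
  flat-level []       lv zero    x∈ with i , eq ← flat-∈ (lv 0) (lv ∘ suc) x∈ = suc i , eq
  flat-level []       lv (suc d) x∈ with i , eq ← flat-level (lv 0) (lv ∘ suc) d x∈ = suc i , eq
  flat-level (_ ∷ xs) lv d       x∈ with i , eq ← flat-level xs lv d x∈ = suc i , eq

  -- Every passage to a new list uses up one index, so the first `j` entries reach no further than
  -- the first `j` lists.
  flat-mass : ∀ (w : A → ℚ) → (∀ x → 0ℚ ≤ w x) → ∀ xs lv j l → j ℕ.≤ l →
    ∑ (applyUpTo (flat xs lv) j) (maybe w 0ℚ) ≤ ∑ xs w + ∑ (applyUpTo lv l) (λ ys → ∑ ys w)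
  flat-mass w 0≤w xs lv zero l _ =
    ℚ.+-mono-≤ (∑-≥0 xs 0≤w) (∑-≥0 (applyUpTo lv l) (λ ys → ∑-≥0 ys 0≤w))
  flat-mass w 0≤w (x ∷ xs) lv (suc j) l j<l =
    subst (_ ≤_) (sym (ℚ.+-assoc (w x) (∑ xs w) (∑ (applyUpTo lv l) (λ ys → ∑ ys w))))
      (ℚ.+-monoʳ-≤ (w x) (flat-mass w 0≤w xs lv j l (ℕ.<⇒≤ j<l)))
  flat-mass w 0≤w [] lv (suc j) (suc l) (s≤s j≤l) =
    ℚ.+-monoʳ-≤ 0ℚ (flat-mass w 0≤w (lv 0) (lv ∘ suc) j l j≤l)

-- Walks of fixed length

module _ {n k : ℕ} where

  startsAt? : ∀ s (p : List (Triple n k)) → Dec (StartsAt s p)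
  startsAt? s []      = yes _
  startsAt? s (x ∷ p) = src x Fin.≟ s

  -- Steps of probability zero are included: the list then depends on no chain, and such walks add
  -- nothing to sums weighted by `ℙ`.
  walks : Fin k → ℕ → List (List (Triple n k))
  walks s zero    = [ [] ]
  walks s (suc d) = concatMap (λ x → map ((s , x) ∷_) (walks (proj₂ x) d)) (steps n k)

  ∑-walks-suc : ∀ s d (f : List (Triple n k) → ℚ) →
    ∑ (walks s (suc d)) f ≡ ∑ (steps n k) (λ x → ∑ (walks (proj₂ x) d) (λ q → f ((s , x) ∷ q)))
  ∑-walks-suc s d f =
    trans (∑-concatMap (λ x → map ((s , x) ∷_) (walks (proj₂ x) d)) (steps n k) f)
          (∑-cong (steps n k) λ x _ → ∑-map ((s , x) ∷_) (walks (proj₂ x) d) f)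

-- Covers given by levels of finite paths

module _ {n k : ℕ} (M : MC n k) where
  open MC M

  Certified : Set
  Certified = Σ[ p ∈ List (Triple n k) ] IsPath M p × StartsAt sinit p

  certify : List (Triple n k) → Maybe Certified
  certify p with isPath? M p ×-dec startsAt? sinit p
  ... | yes h = just (p , h)
  ... | no _  = nothing

  certify-path : ∀ {p} → IsPath M p → StartsAt sinit p → ∃ λ h → certify p ≡ just (p , h)
  certify-path {p} path start with isPath? M p ×-dec startsAt? sinit p
  ... | yes h = h , refl
  ... | no ¬h = contradiction (path , start) ¬h

  certify-mass : ∀ p → maybe (ℙ M ∘ proj₁) 0ℚ (certify p) ≤ ℙ M p
  certify-mass p with isPath? M p ×-dec startsAt? sinit p
  ... | yes _ = ℚ.≤-refl
  ... | no _  = 0≤ℙ M p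

  prefix-starts : ∀ (ω : ℕ → Triple n k) i → src (ω 0) ≡ sinit → StartsAt sinit (applyUpTo ω i)
  prefix-starts ω zero    h = _
  prefix-starts ω (suc i) h = h

  -- Entries of the levels that are not paths from `sinit` are dropped. This cannot raise the mass,
  -- and it keeps every prefix of a path from `sinit`.
  cover : (ℕ → List (List (Triple n k))) → Family M
  cover lv i = flat [] lv i >>= certify

  cover-covers : ∀ lv {X : PathsFromInit M → Set} →
    (∀ ω → X ω → ∃₂ λ d j → applyUpTo (proj₁ ω) j ∈ₗ lv d) → Covers M (cover lv) X
  cover-covers lv h (ω , path , start) x
    with d , j , u∈ ← h (ω , path , start) x
    with i , eq ← flat-level [] lv d u∈
    with c , eq′ ← certify-path (infPath-prefix M ω path j) (prefix-starts ω j start)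
    = i , (applyUpTo ω j , c) , trans (cong (_>>= certify) eq) eq′ ,
      cong (applyUpTo ω) (List.length-applyUpTo ω j)

  cover-mass : ∀ lv {r} → (∀ j → ∑ (applyUpTo lv j) (λ us → ∑ us (ℙ M)) ≤ r) →
               ∀ j → partialMass M (cover lv) j ≤ r
  cover-mass lv h j = ℚ.≤-trans (go (flat [] lv) j)
    (ℚ.≤-trans (flat-mass (ℙ M) (0≤ℙ M) [] lv j j ℕ.≤-refl)
      (subst (_≤ _) (sym (ℚ.+-identityˡ _)) (h j)))
    where
    certified : ∀ m → maybe (ℙ M ∘ proj₁) 0ℚ (m >>= certify) ≤ maybe (ℙ M) 0ℚ m
    certified nothing  = ℚ.≤-refl
    certified (just p) = certify-mass p

    go : ∀ f j → ∑ (applyUpTo (λ i → f i >>= certify) j) (maybe (ℙ M ∘ proj₁) 0ℚ) ≤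
                 ∑ (applyUpTo f j) (maybe (ℙ M) 0ℚ)
    go f zero    = ℚ.≤-refl
    go f (suc j) = ℚ.+-mono-≤ (certified (f 0)) (go (f ∘ suc) j)

-- Probabilities of walks

module _ {n k : ℕ} (M : MC n k) where
  open MC M
  open ≡-Reasoning

  ℙ-++ : ∀ p q → ℙ M (p ++ q) ≡ ℙ M p * ℙ M q
  ℙ-++ []      q = sym (ℚ.*-identityˡ (ℙ M q))
  ℙ-++ ((s , c , s′) ∷ p) q =
    trans (cong (δ s c s′ *_) (ℙ-++ p q)) (sym (ℚ.*-assoc (δ s c s′) (ℙ M p) (ℙ M q)))

  ∑-row : ∀ s a → ∑ (steps n k) (λ (c , s′) → δ s c s′ * a) ≡ a
  ∑-row s a = begin
    ∑ (steps n k) (λ (c , s′) → δ s c s′ * a)  ≡⟨ ∑-cong (steps n k) (λ (c , s′) _ → ℚ.*-comm (δ s c s′) a) ⟩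
    ∑ (steps n k) (λ (c , s′) → a * δ s c s′)  ≡⟨ ∑-*ˡ (steps n k) a (λ (c , s′) → δ s c s′) ⟩
    a * ∑ (steps n k) (λ (c , s′) → δ s c s′)  ≡⟨ cong (a *_) (∑δ≡1 s) ⟩
    a * 1ℚ                                     ≡⟨ ℚ.*-identityʳ a ⟩
    a                                          ∎

  ∑-walks-when : ∀ s d {P : List (Triple n k) → Set} (P? : ∀ q → Dec (P q)) →
    ∑ (walks s (suc d)) (λ q → when (P? q) (ℙ M q)) ≡
    ∑ (steps n k) (λ x → δ s (proj₁ x) (proj₂ x) *
      ∑ (walks (proj₂ x) d) (λ q → when (P? ((s , x) ∷ q)) (ℙ M q)))
  ∑-walks-when s d P? = trans (∑-walks-suc s d (λ q → when (P? q) (ℙ M q)))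
    (∑-cong (steps n k) λ x _ → trans
      (∑-cong (walks (proj₂ x) d) λ q _ → when-*ˡ (P? ((s , x) ∷ q)) (δ s (proj₁ x) (proj₂ x)) (ℙ M q))
      (∑-*ˡ (walks (proj₂ x) d) (δ s (proj₁ x) (proj₂ x)) (λ q → when (P? ((s , x) ∷ q)) (ℙ M q))))

  -- The last step is summed out by the row sum 1. This consistency of cylinder masses lets events
  -- about walks of lengths `d` and `suc d` be compared over the same walks.
  ∑-walks-take : ∀ s d {P : List (Triple n k) → Set} (P? : ∀ q → Dec (P q)) →
    ∑ (walks s (suc d)) (λ q → when (P? (take d q)) (ℙ M q)) ≡
    ∑ (walks s d) (λ q → when (P? q) (ℙ M q))
  ∑-walks-take s zero    P? =
    trans (∑-walks-when s zero (λ q → P? (take zero q))) (∑-row s (when (P? []) 1ℚ + 0ℚ))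
  ∑-walks-take s (suc d) P? =
    trans (∑-walks-when s (suc d) (λ q → P? (take (suc d) q)))
      (trans (∑-cong (steps n k) λ x _ → cong (δ s (proj₁ x) (proj₂ x) *_)
                (∑-walks-take (proj₂ x) d (λ q → P? ((s , x) ∷ q))))
        (sym (∑-walks-when s d P?)))

  ∑-walks : ∀ s d → ∑ (walks s d) (ℙ M) ≡ 1ℚ
  ∑-walks s zero    = refl
  ∑-walks s (suc d) = begin
    ∑ (walks s (suc d)) (ℙ M)
      ≡⟨ ∑-walks-suc s d (ℙ M) ⟩
    ∑ (steps n k) (λ x → ∑ (walks (proj₂ x) d) (λ q → δ s (proj₁ x) (proj₂ x) * ℙ M q))
      ≡⟨ ∑-cong (steps n k) (λ x _ → trans (∑-*ˡ (walks (proj₂ x) d) (δ s (proj₁ x) (proj₂ x)) (ℙ M))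
           (cong (δ s (proj₁ x) (proj₂ x) *_) (∑-walks (proj₂ x) d))) ⟩
    ∑ (steps n k) (λ (c , s′) → δ s c s′ * 1ℚ)
      ≡⟨ ∑-row s 1ℚ ⟩
    1ℚ ∎

  isPath-++⁻ʳ : ∀ b {p} → IsPath M (b ++ p) → IsPath M p
  isPath-++⁻ʳ []      h              = h
  isPath-++⁻ʳ (x ∷ b) (_ ∷ es , lk) = isPath-++⁻ʳ b (es , Linked.tail lk)

  links-starts : ∀ b {p s} → Links M (b ++ p) → lastState b ≡ just s → StartsAt s p
  links-starts (x ∷ [])    {[]}    lk       ls   = _
  links-starts (x ∷ [])    {y ∷ p} (eq ∷ _) refl = sym eq
  links-starts (x ∷ y ∷ b)         (_ ∷ lk) ls   = links-starts (y ∷ b) lk ls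

  ℙ>0 : ∀ {p} → All (IsEdge M) p → 0ℚ < ℙ M p
  ℙ>0 []                                = ℚ.positive⁻¹ 1ℚ
  ℙ>0 {(s , c , s′) ∷ p} (h ∷ hs) = ℚ.positive⁻¹ _
    {{ℚ.pos*pos⇒pos (δ s c s′) {{Rational.positive h}} (ℙ M p) {{Rational.positive (ℙ>0 hs)}}}}

-- Expansions of edges and paths of the replaced chain

module Replacement {n k m : ℕ} (M : MC n k) (A : DRA n m) (separated : LabelsSeparated A)
                   (e : Triple n k) (edge : IsEdge M e) (r : Replaceable M A e) where
  open MC M
  open Replaceable r
  open IsMCCS isMCCS

  R : MC n k
  R = replacedMC M A e r separated edge

  private
    blocks : List (List (Triple n k))
    blocks = mccsList M A e isMCCS

    ∈⇒T : ∀ {p} → p ∈ₗ blocks → MCCS p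
    ∈⇒T {p} = Equivalence.to (mccsList-⇔ M A e isMCCS p)

    T⇒∈ : ∀ {p} → MCCS p → p ∈ₗ blocks
    T⇒∈ {p} = Equivalence.from (mccsList-⇔ M A e isMCCS p)

  Kept : Triple n k → Set
  Kept x = x ≢ e × IsEdge M x

  kept? : ∀ x → Dec (Kept x)
  kept? x = ¬? (x ≟ₜ e) ×-dec (0ℚ ℚ.<? δ (src x) (label x) (tgt x))

  Replaces : Triple n k → List (Triple n k) → Set
  Replaces x t = src x ≡ src e × _∼_ A (trace t) [ label x ] × lastState t ≡ just (tgt x)

  replaces? : ∀ x t → Dec (Replaces x t)
  replaces? x t = (src x Fin.≟ src e) ×-dec inT? M A e isMCCS (label x) (tgt x) t

  expansions : Triple n k → List (List (Triple n k))
  expansions x = filter (λ _ → kept? x) [ [ x ] ] ++ filter (replaces? x) blocks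

  -- Both constructors can apply to an edge leaving the source of `e`: its probability in `R` is the
  -- one it has in `M` plus the mass of the MCCS paths it stands for.
  data Expansion (x : Triple n k) : List (Triple n k) → Set where
    keep    : Kept x → Expansion x [ x ]
    replace : ∀ {t} → MCCS t → Replaces x t → Expansion x t

  expansion⁺ : ∀ {x b} → Expansion x b → b ∈ₗ expansions x
  expansion⁺ {x} (keep h)          = ∈-++⁺ˡ (∈-filter⁺ (λ _ → kept? x) (here refl) h)
  expansion⁺ {x} (replace {t} h g) =
    ∈-++⁺ʳ (filter (λ _ → kept? x) [ [ x ] ]) (∈-filter⁺ (replaces? x) (T⇒∈ h) g)

  expansion⁻ : ∀ {x b} → b ∈ₗ expansions x → Expansion x b
  expansion⁻ {x} b∈ with ∈-++⁻ (filter (λ _ → kept? x) [ [ x ] ]) b∈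
  ... | inj₂ b∈ʳ with t∈ , h ← ∈-filter⁻ (replaces? x) {xs = blocks} b∈ʳ = replace (∈⇒T t∈) h
  ... | inj₁ b∈ˡ with ∈-filter⁻ (λ _ → kept? x) {xs = [ [ x ] ]} b∈ˡ
  ...   | here refl , h = keep h

  expansion-path : ∀ {x b} → Expansion x b → IsPath M b
  expansion-path (keep (_ , h))  = h ∷ [] , [-]
  expansion-path (replace Tt _) = proj₁ (paths Tt)

  expansion-∼ : ∀ {x b} → Expansion x b → _∼_ A (trace b) [ label x ]
  expansion-∼ {x} (keep _)                = proj₂ (good-single A (label x))
  expansion-∼     (replace _ (_ , h , _)) = h

  expansion-last : ∀ {x b} → Expansion x b → lastState b ≡ just (tgt x)
  expansion-last (keep _)                = refl
  expansion-last (replace _ (_ , _ , h)) = h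

  expansion-head : ∀ {x b} → Expansion x b → ∃₂ λ y b′ → b ≡ y ∷ b′ × src y ≡ src x
  expansion-head (keep _) = _ , [] , refl , refl
  expansion-head (replace {t} Tt (eq , _)) with refl ∷ _ ← proj₂ (paths Tt) = _ , _ , refl , sym eq

  ∑-expansions : ∀ x (f : List (Triple n k) → ℚ) →
    ∑ (expansions x) f ≡ when (kept? x) (f [ x ]) + ∑ blocks (λ t → when (replaces? x t) (f t))
  ∑-expansions x f = trans (∑-++ (filter (λ _ → kept? x) [ [ x ] ]) (filter (replaces? x) blocks) f)
    (cong₂ _+_ (trans (∑-filter (λ _ → kept? x) [ [ x ] ] f) (ℚ.+-identityʳ (when (kept? x) (f [ x ]))))
               (∑-filter (replaces? x) blocks f))

  ∑-expansions-ℙ : ∀ s c s′ → ∑ (expansions (s , c , s′)) (ℙ M) ≡ δᴿ M A e r s c s′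
  ∑-expansions-ℙ s c s′ =
    trans (∑-expansions (s , c , s′) (ℙ M)) (go ((s , c , s′) ≟ₜ e) (s Fin.≟ src e))
    where
    kept : (s , c , s′) ≢ e → when (kept? (s , c , s′)) (ℙ M [ s , c , s′ ]) ≡ δ s c s′
    kept ne = by-cases (0ℚ ℚ.<? δ s c s′)
      where
      by-cases : Dec (0ℚ < δ s c s′) → when (kept? (s , c , s′)) (ℙ M [ s , c , s′ ]) ≡ δ s c s′
      by-cases (yes pos) = trans (when-yes (kept? (s , c , s′)) (ne , pos)) (ℚ.*-identityʳ (δ s c s′))
      by-cases (no ¬pos) = trans (when-no (kept? (s , c , s′)) (¬pos ∘ proj₂))
                                 (ℚ.≤-antisym (0≤δ s c s′) (ℚ.≮⇒≥ ¬pos))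

    replaced : s ≡ src e → ∑ blocks (λ t → when (replaces? (s , c , s′) t) (ℙ M t)) ≡ mass M A e isMCCS c s′
    replaced eq = trans
      (∑-cong blocks λ t _ → when-⇔ (replaces? (s , c , s′) t) (inT? M A e isMCCS c s′ t) proj₂ (eq ,_))
      (sym (∑-filter (inT? M A e isMCCS c s′) blocks (ℙ M)))

    go : (d : Dec ((s , c , s′) ≡ e)) (d′ : Dec (s ≡ src e)) →
         when (kept? (s , c , s′)) (ℙ M [ s , c , s′ ]) +
           ∑ blocks (λ t → when (replaces? (s , c , s′) t) (ℙ M t)) ≡
         (if does d then 0ℚ
          else if does d′ then δ (src e) c s′ + mass M A e isMCCS c s′
          else δ s c s′)
    -- Here `δᴿ` is 0. The edge `e` is not kept, and no MCCS path ends in the target of `e`, as it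
    -- would then visit that state twice.
    go (yes eq) _ = cong₂ _+_ (when-no (kept? (s , c , s′)) (λ h → proj₁ h eq))
      (trans (replaced (cong src eq))
        (trans (cong (mass M A e isMCCS c) (cong tgt eq)) (mass-tgt M A e isMCCS c)))
    go (no ne) (yes refl) = cong₂ _+_ (kept ne) (replaced refl)
    go (no ne) (no ne′)   = trans
      (cong₂ _+_ (kept ne) (trans
        (∑-cong blocks λ t _ → when-no (replaces? (s , c , s′) t) (ne′ ∘ proj₁)) (∑-zero blocks)))
      (ℚ.+-identityʳ (δ s c s′))

  -- The positive number `ℙ M b` is one term of the nonnegative sum that gives the probability of
  -- `x` in `R`.
  expansion-edge : ∀ {x b} → Expansion x b → IsEdge R x
  expansion-edge {s , c , s′} {b} ex = ℚ.<-≤-trans (ℙ>0 M (proj₁ (expansion-path ex)))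
    (subst (ℙ M b ≤_) (∑-expansions-ℙ s c s′)
      (term≤∑ (expansions (s , c , s′)) (0≤ℙ M) (expansion⁺ ex)))

  expand : List (Triple n k) → List (List (Triple n k))
  expand []      = [ [] ]
  expand (x ∷ q) = cartesianProductWith _++_ (expansions x) (expand q)

  ∑-expand-∷ : ∀ x q (f : List (Triple n k) → ℚ) →
    ∑ (expand (x ∷ q)) f ≡ ∑ (expansions x) (λ b → ∑ (expand q) (λ u → f (b ++ u)))
  ∑-expand-∷ x q f = ∑-cartesianProductWith _++_ (expansions x) (expand q) f

  -- By multiplicativity of `ℙ` the sum factors edge by edge. Hence replacing a cylinder of `R` by
  -- its expansions preserves the mass.
  ∑-expand : ∀ q → ∑ (expand q) (ℙ M) ≡ ℙ R q
  ∑-expand []      = refl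
  ∑-expand (x@(s , c , s′) ∷ q) = begin
    ∑ (expand (x ∷ q)) (ℙ M)
      ≡⟨ ∑-expand-∷ x q (ℙ M) ⟩
    ∑ (expansions x) (λ b → ∑ (expand q) (λ u → ℙ M (b ++ u)))
      ≡⟨ ∑-cong (expansions x) (λ b _ → trans (∑-cong (expand q) λ u _ → ℙ-++ M b u)
           (trans (∑-*ˡ (expand q) (ℙ M b) (ℙ M))
             (trans (cong (ℙ M b *_) (∑-expand q)) (ℚ.*-comm (ℙ M b) (ℙ R q))))) ⟩
    ∑ (expansions x) (λ b → ℙ R q * ℙ M b)
      ≡⟨ ∑-*ˡ (expansions x) (ℙ R q) (ℙ M) ⟩
    ℙ R q * ∑ (expansions x) (ℙ M)
      ≡⟨ cong (ℙ R q *_) (∑-expansions-ℙ s c s′) ⟩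
    ℙ R q * δᴿ M A e r s c s′
      ≡⟨ ℚ.*-comm (ℙ R q) (δᴿ M A e r s c s′) ⟩
    ℙ R (x ∷ q) ∎
    where open ≡-Reasoning

  -- `expand` recurses on the first edge, whereas a parsing grows at its last one.
  expand-∷ʳ : ∀ q {x u b} → u ∈ₗ expand q → Expansion x b → (u ++ b) ∈ₗ expand (q ∷ʳ x)
  expand-∷ʳ []      {x} {b = b} (here refl) ex = subst (_∈ₗ expand [ x ]) (List.++-identityʳ b)
    (∈-cartesianProductWith⁺ _++_ (expansion⁺ ex) (here refl))
  expand-∷ʳ (y ∷ q) {x} {b = b} u∈ ex
    with b′ , u′ , b′∈ , u′∈ , refl ← ∈-cartesianProductWith⁻ _++_ (expansions y) (expand q) u∈ =
    subst (_∈ₗ expand (y ∷ q ∷ʳ x)) (sym (List.++-assoc b′ u′ b))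
      (∈-cartesianProductWith⁺ _++_ b′∈ (expand-∷ʳ q u′∈ ex))

  expand-⊑ : ∀ {q q′ u} → q′ ⊑ q → u ∈ₗ expand q → ∃ λ u′ → u′ ∈ₗ expand q′ × u′ ⊑ u
  expand-⊑         []                _  = [] , here refl , []
  expand-⊑ {x ∷ q} (refl ∷ h) u∈
    with b , u , b∈ , u∈q , refl ← ∈-cartesianProductWith⁻ _++_ (expansions x) (expand q) u∈
    with u′ , u′∈ , pre ← expand-⊑ h u∈q =
    b ++ u′ , ∈-cartesianProductWith⁺ _++_ b∈ u′∈ , ++-⊑⁺ b pre

  ∑-expand-walks : Fin k → ℕ → (List (Triple n k) → ℚ) → ℚ
  ∑-expand-walks s d f = ∑ (walks s d) (λ q → ∑ (expand q) f)

  -- Splits off the first block; this is the recursion behind the prefix-code inequality.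
  ∑-expand-walks-suc : ∀ s d f → ∑-expand-walks s (suc d) f ≡
    ∑ (steps n k) (λ x → ∑ (expansions (s , x)) (λ b → ∑-expand-walks (proj₂ x) d (λ u → f (b ++ u))))
  ∑-expand-walks-suc s d f = trans (∑-walks-suc s d (λ q → ∑ (expand q) f))
    (∑-cong (steps n k) λ x _ → trans
      (∑-cong (walks (proj₂ x) d) λ q _ → ∑-expand-∷ (s , x) q f)
      (∑-swap (walks (proj₂ x) d) (expansions (s , x)) (λ q b → ∑ (expand q) (λ u → f (b ++ u)))))

  ∑-expand-walks-ℙ : ∀ s d → ∑-expand-walks s d (ℙ M) ≡ 1ℚ
  ∑-expand-walks-ℙ s d = trans (∑-cong (walks s d) λ q _ → ∑-expand q) (∑-walks R s d)

  -- The prefix-code inequality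

  _≼?_ : (p u : List (Triple n k)) → Dec (p ⊑ u)
  _≼?_ = prefix? _≟ₜ_

  below : List (Triple n k) → List (Triple n k) → ℚ
  below p u = when (p ≼? u) (ℙ M u)

  0≤below : ∀ p u → 0ℚ ≤ below p u
  0≤below p u = when-≥0 (p ≼? u) (0≤ℙ M u)

  module _ (s : Fin k) (d : ℕ) where

    below-zero : ∀ p b → (∀ u → ¬ (p ⊑ (b ++ u))) → ∑-expand-walks s d (λ u → below p (b ++ u)) ≡ 0ℚ
    below-zero p b h = trans
      (∑-cong (walks s d) λ q _ → trans
        (∑-cong (expand q) λ u _ → when-no (p ≼? (b ++ u)) (h u)) (∑-zero (expand q)))
      (∑-zero (walks s d))

    ∑-expand-walks-*ˡ : ∀ a f → ∑-expand-walks s d (λ u → a * f u) ≡ a * ∑-expand-walks s d f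
    ∑-expand-walks-*ˡ a f = trans (∑-cong (walks s d) λ q _ → ∑-*ˡ (expand q) a f)
      (∑-*ˡ (walks s d) a (λ q → ∑ (expand q) f))

    ∑-expand-walks-mono : ∀ {f g} → (∀ u → f u ≤ g u) → ∑-expand-walks s d f ≤ ∑-expand-walks s d g
    ∑-expand-walks-mono h = ∑-mono (walks s d) λ q _ → ∑-mono (expand q) λ u _ → h u

    -- The continuations of `b` have total mass `ℙ M b`, because all expansions of walks of one
    -- length from `s` together have mass 1.
    below-all : ∀ p b → ∑-expand-walks s d (λ u → below p (b ++ u)) ≤ ℙ M b
    below-all p b = begin
      ∑-expand-walks s d (λ u → below p (b ++ u))
        ≤⟨ ∑-expand-walks-mono (λ u → ℚ.≤-trans (when-≤ (p ≼? (b ++ u)) (0≤ℙ M (b ++ u)))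
             (ℚ.≤-reflexive (ℙ-++ M b u))) ⟩
      ∑-expand-walks s d (λ u → ℙ M b * ℙ M u)
        ≡⟨ ∑-expand-walks-*ˡ (ℙ M b) (ℙ M) ⟩
      ℙ M b * ∑-expand-walks s d (ℙ M)
        ≡⟨ cong (ℙ M b *_) (∑-expand-walks-ℙ s d) ⟩
      ℙ M b * 1ℚ
        ≡⟨ ℚ.*-identityʳ (ℙ M b) ⟩
      ℙ M b ∎
      where open ℚ.≤-Reasoning

    -- A common first block cancels on the level of prefixes and becomes the factor `ℙ M b` on the
    -- level of masses.
    below-block : ∀ p b → ∑-expand-walks s d (below p) ≤ ℙ M p →
                  ∑-expand-walks s d (λ u → below (b ++ p) (b ++ u)) ≤ ℙ M (b ++ p)
    below-block p b h = begin
      ∑-expand-walks s d (λ u → below (b ++ p) (b ++ u))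
        ≤⟨ ∑-expand-walks-mono (λ u → ℚ.≤-reflexive (factor u)) ⟩
      ∑-expand-walks s d (λ u → ℙ M b * below p u)
        ≡⟨ ∑-expand-walks-*ˡ (ℙ M b) (below p) ⟩
      ℙ M b * ∑-expand-walks s d (below p)
        ≤⟨ *-monoˡ-≤₀ (ℙ M b) (0≤ℙ M b) h ⟩
      ℙ M b * ℙ M p
        ≡⟨ sym (ℙ-++ M b p) ⟩
      ℙ M (b ++ p) ∎
      where
      open ℚ.≤-Reasoning
      factor : ∀ u → below (b ++ p) (b ++ u) ≡ ℙ M b * below p u
      factor u = trans (when-⇔ ((b ++ p) ≼? (b ++ u)) (p ≼? u) (++-⊑⁻ b) (++-⊑⁺ b))
        (trans (cong (when (p ≼? u)) (ℙ-++ M b u)) (when-*ˡ (p ≼? u) (ℙ M b) (ℙ M u)))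

  -- A strict prefix lying in MCCS would be equivalent to a single label and different from `[ e ]`,
  -- against minimality of the longer path.
  mccs-antichain : ∀ {t t′} → MCCS t → MCCS t′ → t ⊑ t′ → t ≡ t′
  mccs-antichain {t} {t′} Tt Tt′ pre with List.≡-dec _≟ₜ_ t t′
  ... | yes eq = eq
  ... | no ne with c , sim ← mccs-good M A e isMCCS Tt =
    contradiction sim (minimal Tt′ t pre ne (λ eq → e∉T (subst MCCS eq Tt)) c)

  -- An MCCS path replaces at most one edge from `s`: its last state fixes the target, and by
  -- `separated` its trace is equivalent to only one label.
  ∑-replaces : ∀ s {t v} → MCCS t → 0ℚ ≤ v → ∑ (steps n k) (λ x → when (replaces? (s , x) t) v) ≤ v
  ∑-replaces s {[]} Tt _ with () ← proj₂ (paths Tt)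
  ∑-replaces s {y ∷ t} {v} Tt 0≤v
    with c , _ , ap , eq ← mccs-good M A e isMCCS Tt | s′ , ls ← lastState-∷ y t = subst (_≤ v)
      (sym (∑-single (steps n k) _ (steps-unique n k) (steps-complete n k (c , s′)) others))
      (when-≤ (replaces? (s , c , s′) (y ∷ t)) 0≤v)
    where
    others : ∀ x → x ∈ₗ steps n k → x ≢ (c , s′) → when (replaces? (s , x) (y ∷ t)) v ≡ 0ℚ
    others x@(c₁ , s₁) _ ne = when-no (replaces? (s , x) (y ∷ t)) λ (_ , (_ , ap₁ , eq₁) , ls₁) →
      ne (cong₂ _,_ (separated c₁ c (ap₁ , ap , λ q → trans (sym (eq₁ q)) (eq q)))
                    (Maybe.just-injective (trans (sym ls₁) ls)))

  -- This holds because the expansions of the walks of length d form a prefix code.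

  ∑-below : ∀ d s p → IsPath M p → StartsAt s p → ∑-expand-walks s d (below p) ≤ ℙ M p
  ∑-below d       s []        path start = ℚ.≤-trans (below-all s d [] []) ℚ.≤-refl
  -- The only expansion of the empty walk is `[]`, which has no nonempty prefix, so the left side
  -- computes to 0.
  ∑-below zero    s (y ∷ p)   path start = 0≤ℙ M (y ∷ p)
  ∑-below (suc d) s (y ∷ p)   path refl  = ℚ.≤-trans (ℚ.≤-reflexive split) (go (y ≟ₜ e))
    where
    open ℚ.≤-Reasoning

    rest : Label n × Fin k → List (Triple n k) → ℚ
    rest x b = ∑-expand-walks (proj₂ x) d (λ u → below (y ∷ p) (b ++ u))

    keeping replacing : Label n × Fin k → ℚ
    keeping   x = when (kept? (s , x)) (rest x [ s , x ])
    replacing x = ∑ blocks (λ t → when (replaces? (s , x) t) (rest x t))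

    split : ∑-expand-walks s (suc d) (below (y ∷ p)) ≡ ∑ (steps n k) keeping + ∑ (steps n k) replacing
    split = trans (∑-expand-walks-suc s d (below (y ∷ p)))
      (trans (∑-cong (steps n k) λ x _ → ∑-expansions (s , x) (rest x)) (∑-+ (steps n k) keeping replacing))

    -- By `∑-replaces` no MCCS path is counted for two edges, so it suffices to bound the
    -- contribution of each path `t` by `h t`.
    bounded : ∀ (h : List (Triple n k) → ℚ) → (∀ t → 0ℚ ≤ h t) → ∑ blocks h ≤ ℙ M (y ∷ p) →
              (∀ x t → MCCS t → Replaces (s , x) t → rest x t ≤ h t) →
              ∑ (steps n k) replacing ≤ ℙ M (y ∷ p)
    bounded h 0≤h ∑h le = begin
      ∑ (steps n k) replacing
        ≤⟨ ∑-mono (steps n k) (λ x _ → ∑-mono blocks λ t t∈ → when-mono x t (∈⇒T t∈)) ⟩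
      ∑ (steps n k) (λ x → ∑ blocks (λ t → when (replaces? (s , x) t) (h t)))
        ≡⟨ ∑-swap (steps n k) blocks (λ x t → when (replaces? (s , x) t) (h t)) ⟩
      ∑ blocks (λ t → ∑ (steps n k) (λ x → when (replaces? (s , x) t) (h t)))
        ≤⟨ ∑-mono blocks (λ t t∈ → ∑-replaces s (∈⇒T t∈) (0≤h t)) ⟩
      ∑ blocks h
        ≤⟨ ∑h ⟩
      ℙ M (y ∷ p) ∎
      where
      when-mono : ∀ x t → MCCS t → when (replaces? (s , x) t) (rest x t) ≤ when (replaces? (s , x) t) (h t)
      when-mono x t Tt with replaces? (s , x) t
      ... | yes rep = le x t Tt rep
      ... | no _    = ℚ.≤-refl

    go : Dec (y ≡ e) → ∑ (steps n k) keeping + ∑ (steps n k) replacing ≤ ℙ M (y ∷ p)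
    -- All MCCS paths start with `e`, so `[ y ]` is the only first block compatible with `y ∷ p`,
    -- and the induction applies to `p`.
    go (no y≢e) = begin
      ∑ (steps n k) keeping + ∑ (steps n k) replacing
        ≡⟨ cong₂ _+_ single (trans (∑-cong (steps n k) λ x _ → none x) (∑-zero (steps n k))) ⟩
      keeping (proj₂ y) + 0ℚ
        ≡⟨ ℚ.+-identityʳ _ ⟩
      keeping (proj₂ y)
        ≤⟨ when-≤ (kept? y) (∑-≥0 (walks (tgt y) d) λ q → ∑-≥0 (expand q) λ u → 0≤below (y ∷ p) (y ∷ u)) ⟩
      rest (proj₂ y) [ y ]
        ≤⟨ below-block (tgt y) d p [ y ]
             (∑-below d (tgt y) p (isPath-++⁻ʳ M [ y ] path) (links-starts M [ y ] (proj₂ path) refl)) ⟩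
      ℙ M (y ∷ p) ∎
      where
      single : ∑ (steps n k) keeping ≡ keeping (proj₂ y)
      single = ∑-single (steps n k) keeping (steps-unique n k) (steps-complete n k (proj₂ y)) λ x _ ne →
        trans (cong (when (kept? (s , x)))
                (below-zero (proj₂ x) d (y ∷ p) [ s , x ] λ { u (eq ∷ _) → ne (cong proj₂ (sym eq)) }))
              (when-0 (kept? (s , x)))
      none : ∀ x → replacing x ≡ 0ℚ
      none x = trans (∑-cong blocks λ t t∈ → trans
          (cong (when (replaces? (s , x) t)) (below-zero (proj₂ x) d (y ∷ p) t (absurd t (∈⇒T t∈))))
          (when-0 (replaces? (s , x) t)))
        (∑-zero blocks)
        where
        absurd : ∀ t → MCCS t → ∀ u → ¬ ((y ∷ p) ⊑ (t ++ u))
        absurd t Tt u pre with refl ∷ _ ← proj₂ (paths Tt) | eq ∷ _ ← pre = y≢e eq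
    -- Kept edges differ from `e`, so the first block is an MCCS path. Either some MCCS path is
    -- already a prefix of `e ∷ p`, or `e ∷ p` ends inside the first block.
    go (yes refl) = begin
      ∑ (steps n k) keeping + ∑ (steps n k) replacing
        ≡⟨ cong (_+ ∑ (steps n k) replacing)
             (trans (∑-cong (steps n k) λ x _ → none x) (∑-zero (steps n k))) ⟩
      0ℚ + ∑ (steps n k) replacing
        ≡⟨ ℚ.+-identityˡ _ ⟩
      ∑ (steps n k) replacing
        ≤⟨ by-prefix (Any.any? (_≼? (e ∷ p)) blocks) ⟩
      ℙ M (e ∷ p) ∎
      where
      none : ∀ x → keeping x ≡ 0ℚ
      none x with kept? (s , x)
      ... | no _         = refl
      ... | yes (ne , _) = below-zero (proj₂ x) d (e ∷ p) [ s , x ] λ { u (eq ∷ _) → ne (sym eq) }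

      by-prefix : Dec (Any.Any (_⊑ (e ∷ p)) blocks) → ∑ (steps n k) replacing ≤ ℙ M (e ∷ p)
      -- By the antichain property `t₀` is the only possible first block, so the whole bound is put
      -- on it and the induction applies to the remainder `p′`.
      by-prefix (yes h) with t₀ , t₀∈ , pre ← find h with p′ , eq ← ⊑⇒++ pre =
        bounded (λ t → when (List.≡-dec _≟ₜ_ t t₀) (ℙ M (e ∷ p)))
          (λ t → when-≥0 (List.≡-dec _≟ₜ_ t t₀) (0≤ℙ M (e ∷ p)))
          (ℚ.≤-reflexive (trans
            (∑-single blocks _ (mccsList-unique M A e isMCCS) t₀∈ λ t _ → when-no (List.≡-dec _≟ₜ_ t t₀))
            (when-yes (List.≡-dec _≟ₜ_ t₀ t₀) refl)))
          le
        where
        le : ∀ x t → MCCS t → Replaces (s , x) t →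
             rest x t ≤ when (List.≡-dec _≟ₜ_ t t₀) (ℙ M (e ∷ p))
        le x t Tt (_ , _ , ls) with List.≡-dec _≟ₜ_ t t₀
        ... | yes refl = subst (λ z → ∑-expand-walks (proj₂ x) d (λ u → below z (t ++ u)) ≤ ℙ M z) (sym eq)
          (below-block (proj₂ x) d p′ t (∑-below d (proj₂ x) p′
            (isPath-++⁻ʳ M t (subst (IsPath M) eq path))
            (links-starts M t (subst (Links M) eq (proj₂ path)) ls)))
        ... | no ne = ℚ.≤-reflexive (below-zero (proj₂ x) d (e ∷ p) t λ u pre′ →
          ne (incomparable (⊑-comparable (⊑-++ t u) (⊑-trans pre pre′))))
          where
          incomparable : t ⊑ t₀ ⊎ t₀ ⊑ t → t ≡ t₀
          incomparable (inj₁ h) = mccs-antichain Tt (∈⇒T t₀∈) h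
          incomparable (inj₂ h) = sym (mccs-antichain (∈⇒T t₀∈) Tt h)
      -- No MCCS path is a prefix of `e ∷ p`, so those extending it have total mass `ℙ M (e ∷ p)`.
      -- The fuel is chosen to make the length condition of `massBelow≡ℙ` immediate.
      by-prefix (no ¬h) = bounded (below (e ∷ p)) (0≤below (e ∷ p))
        (ℚ.≤-reflexive (massBelow≡ℙ M A e isMCCS (suc (bound M A e isMCCS)) p path
          (λ p′ pre _ Tp′ → ¬h (lose (T⇒∈ Tp′) pre)) (ℕ.m≤m+n _ _)))
        le
        where
        le : ∀ x t → MCCS t → Replaces (s , x) t → rest x t ≤ below (e ∷ p) t
        le x t Tt _ with (e ∷ p) ≼? t
        ... | yes _   = below-all (proj₂ x) d (e ∷ p) t
        ... | no ¬pre = ℚ.≤-reflexive (below-zero (proj₂ x) d (e ∷ p) t λ u pre →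
          case (⊑-comparable pre (⊑-++ t u)))
          where
          case : ¬ ((e ∷ p) ⊑ t ⊎ t ⊑ (e ∷ p))
          case (inj₁ h) = ¬pre h
          case (inj₂ h) = ¬h (lose (T⇒∈ Tt) h)

-- Recurrence of positions and Rabin acceptance under simulation

uniform-bound : ∀ {A : Set} {P : A → ℕ → Set} → (∀ x {i j} → i ℕ.≤ j → P x i → P x j) →
  ∀ xs → (∀ x → x ∈ₗ xs → ∃ (P x)) → ∃ λ b → ∀ x → x ∈ₗ xs → P x b
uniform-bound mono []       h = 0 , λ _ ()
uniform-bound mono (x ∷ xs) h
  with i , Pi ← h x (here refl) | j , Pj ← uniform-bound mono xs (λ y → h y ∘ there) =
  i ℕ.⊔ j , λ { y (here refl) → mono y (ℕ.m≤m⊔n i j) Pi ; y (there y∈) → mono y (ℕ.m≤n⊔m i j) (Pj y y∈) }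

finitely-many : ∀ {m} (X : Subset m) {ρ : ℕ → Fin m} → (∀ q → q ∈ X → FinitelyOften ρ q) →
                ∃ λ b → ∀ j → b ℕ.≤ j → ¬ (ρ j ∈ X)
finitely-many {m} X {ρ} fin =
  let b , h = uniform-bound mono (allFin m) (λ q _ → eventually q)
  in b , λ j b≤j → h (ρ j) (∈-allFin (ρ j)) j b≤j refl
  where
  Avoids : Fin m → ℕ → Set
  Avoids q i = ∀ j → i ℕ.≤ j → ρ j ≡ q → ¬ (q ∈ X)

  mono : ∀ q {i j} → i ℕ.≤ j → Avoids q i → Avoids q j
  mono q i≤j h l j≤l = h l (ℕ.≤-trans i≤j j≤l)

  eventually : ∀ q → ∃ (Avoids q)
  eventually q with q ∈? X
  ... | yes q∈ with i , h ← fin q q∈ = i , λ j i≤j eq _ → h j i≤j eq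
  ... | no q∉ = 0 , λ _ _ _ → q∉

-- Infinite pigeonhole principle: if each position of `X` occurred only finitely often,
-- `finitely-many` would bound all visits to `X`.
infinitely-many : ExcludedMiddle 0ℓ → ∀ {m} (X : Subset m) {ρ : ℕ → Fin m} →
  (∀ i → ∃ λ j → i ℕ.≤ j × ρ j ∈ X) → ∃ λ q → q ∈ X × InfinitelyOften ρ q
infinitely-many em {m} X {ρ} inf with em {∃ λ q → q ∈ X × InfinitelyOften ρ q}
... | yes h = h
... | no ¬h =
  let b , avoid     = finitely-many X finite
      j , b≤j , ρj∈ = inf b
  in contradiction ρj∈ (avoid j b≤j)
  where
  finite : ∀ q → q ∈ X → FinitelyOften ρ q
  finite q q∈ with em {FinitelyOften ρ q}
  ... | yes fin = fin
  ... | no ¬fin = contradiction (q , q∈ , often) ¬h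
    where
    often : InfinitelyOften ρ q
    often i with em {∃ λ j → i ℕ.≤ j × ρ j ≡ q}
    ... | yes h = h
    ... | no ¬j = contradiction (i , λ j i≤j eq → ¬j (j , i≤j , eq)) ¬fin

-- Simulation of w by w′: the run on w, read at the cuts, is the run on w′,
-- and what it visits in between is visited again at the next cut.

module Simulation {n m : ℕ} (A : DRA n m) (w w′ : ℕ → Label n) (cut len : ℕ → ℕ)
  (cut-zero : cut 0 ≡ 0) (cut-suc : ∀ i → cut (suc i) ≡ cut i ℕ.+ len i)
  (sim : ∀ i → _∼_ A (applyUpTo (λ l → w (cut i ℕ.+ l)) (len i)) [ w′ i ]) where
  open DRA A

  run-+ : ∀ i l → run w (i ℕ.+ l) ≡ Δ* (run w i) (applyUpTo (λ j → w (i ℕ.+ j)) l)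
  run-+ i zero    = cong (run w) (ℕ.+-identityʳ i)
  run-+ i (suc l) = trans (cong (run w) (ℕ.+-suc i l))
    (trans (cong (λ q → Δ q (w (i ℕ.+ l))) (run-+ i l))
      (trans (sym (Δ*-∷ʳ A (run w i) (applyUpTo (λ j → w (i ℕ.+ j)) l) (w (i ℕ.+ l))))
        (cong (Δ* (run w i)) (List.applyUpTo-∷ʳ (λ j → w (i ℕ.+ j)) l))))

  run-cut : ∀ i → run w (cut i) ≡ run w′ i
  run-cut zero    = cong (run w) cut-zero
  run-cut (suc i) = trans (cong (run w) (cut-suc i))
    (trans (run-+ (cut i) (len i))
      (trans (proj₂ (proj₂ (sim i)) (run w (cut i))) (cong (λ q → Δ q (w′ i)) (run-cut i))))

  1≤len : ∀ i → 1 ℕ.≤ len i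
  1≤len i with len i | proj₁ (proj₁ (sim i))
  ... | zero  | ne = contradiction refl ne
  ... | suc _ | _  = s≤s z≤n

  cut-≥ : ∀ i → i ℕ.≤ cut i
  cut-≥ zero    = z≤n
  cut-≥ (suc i) = subst₂ ℕ._≤_ (ℕ.+-comm i 1) (sym (cut-suc i)) (ℕ.+-mono-≤ (cut-≥ i) (1≤len i))

  -- The interval omits its left end and contains its right end, since acceptance preservation
  -- concerns the nonempty prefixes of a block, the whole block included.
  locate : ∀ i j → cut i ℕ.< j → ∃ λ a → i ℕ.≤ a × cut a ℕ.< j × j ℕ.≤ cut (suc a)
  locate i (suc j) (s≤s le) with ℕ.m≤n⇒m<n∨m≡n le
  ... | inj₂ refl = i , ℕ.≤-refl , ℕ.≤-refl , next
    where
    next : suc (cut i) ℕ.≤ cut (suc i)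
    next = subst₂ ℕ._≤_ (ℕ.+-comm (cut i) 1) (sym (cut-suc i)) (ℕ.+-monoʳ-≤ (cut i) (1≤len i))
  ... | inj₁ lt with a , i≤a , lo , hi ← locate i j lt with ℕ.m≤n⇒m<n∨m≡n hi
  ...   | inj₁ j<  = a , i≤a , ℕ.m≤n⇒m≤1+n lo , j<
  ...   | inj₂ j≡  = suc a , ℕ.m≤n⇒m≤1+n i≤a , s≤s (ℕ.≤-reflexive (sym j≡)) ,
    subst₂ ℕ._≤_ (trans (ℕ.+-comm (cut (suc a)) 1) (cong suc (sym j≡))) (sym (cut-suc (suc a)))
      (ℕ.+-monoʳ-≤ (cut (suc a)) (1≤len (suc a)))

  -- Position `j` of the run is reached from the cut by a nonempty prefix of the
  -- acceptance-preserving word of block `a`, so membership is carried to the end of that block.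
  preserved : ∀ a j → cut a ℕ.< j → j ℕ.≤ cut (suc a) → ∀ i →
    (run w j ∈ L i → run w′ (suc a) ∈ L i) × (run w j ∈ U i → run w′ (suc a) ∈ U i)
  preserved a j lo hi i = result (j ℕ.∸ cut a) refl
    where
    t : List (Label n)
    t = applyUpTo (λ l → w (cut a ℕ.+ l)) (len a)

    end : Δ* (run w (cut a)) t ≡ run w′ (suc a)
    end = trans (sym (run-+ (cut a) (len a))) (trans (cong (run w) (sym (cut-suc a))) (run-cut (suc a)))

    result : ∀ l → j ℕ.∸ cut a ≡ l →
      (run w j ∈ L i → run w′ (suc a) ∈ L i) × (run w j ∈ U i → run w′ (suc a) ∈ U i)
    result zero    eq = contradiction (ℕ.m∸n≡0⇒m≤n eq) (ℕ.<⇒≱ lo)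
    result (suc l) eq =
      let f , g = proj₂ (proj₁ (sim a)) (run w (cut a)) (applyUpTo (λ l → w (cut a ℕ.+ l)) (suc l)) (λ ())
                    (applyUpTo-⊑ (λ l → w (cut a ℕ.+ l)) short) i
      in (λ h → subst (_∈ L i) end (f (subst (_∈ L i) here′ h))) ,
         (λ h → subst (_∈ U i) end (g (subst (_∈ U i) here′ h)))
      where
      j≡ : cut a ℕ.+ suc l ≡ j
      j≡ = trans (cong (cut a ℕ.+_) (sym eq)) (ℕ.m+[n∸m]≡n (ℕ.<⇒≤ lo))
      short : suc l ℕ.≤ len a
      short = ℕ.+-cancelˡ-≤ (cut a) (suc l) (len a) (subst₂ ℕ._≤_ (sym j≡) (cut-suc a) hi)
      here′ : run w j ≡ Δ* (run w (cut a)) (applyUpTo (λ l → w (cut a ℕ.+ l)) (suc l))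
      here′ = trans (cong (run w) (sym j≡)) (run-+ (cut a) (suc l))

  -- The run on `w′` is a subsequence of the run on `w`, so recurrence passes from `w′` to `w` and
  -- finiteness from `w` to `w′`. The other two implications rest on `preserved`. It yields at later
  -- cuts merely some position of `L i`, possibly varying, whence the pigeonhole principle.
  accepts⇔ : ExcludedMiddle 0ℓ → Accepts A w ⇔ Accepts A w′
  accepts⇔ em = mk⇔ to from
    where
    to : Accepts A w → Accepts A w′
    to (i , (q , q∈ , inf) , fin) = i , infinitely-many em (L i) often , finite
      where
      often : ∀ b → ∃ λ j → b ℕ.≤ j × run w′ j ∈ L i
      often b with j , le , refl ← inf (suc (cut b)) with a , b≤a , lo , hi ← locate b j le =
        suc a , ℕ.m≤n⇒m≤1+n b≤a , proj₁ (preserved a j lo hi i) q∈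
      finite : ∀ q′ → q′ ∈ U i → FinitelyOften (run w′) q′
      finite q′ q′∈ with b , h ← fin q′ q′∈ =
        b , λ j b≤j eq → h (cut j) (ℕ.≤-trans b≤j (cut-≥ j)) (trans (run-cut j) eq)

    from : Accepts A w′ → Accepts A w
    from (i , (q , q∈ , inf) , fin) = i , (q , q∈ , often) , finite
      where
      often : InfinitelyOften (run w) q
      often b with j , b≤j , eq ← inf b = cut j , ℕ.≤-trans b≤j (cut-≥ j) , trans (run-cut j) eq
      finite : ∀ q′ → q′ ∈ U i → FinitelyOften (run w) q′
      finite q′ q′∈ with b , avoid ← finitely-many (U i) fin =
        suc (cut b) , λ { j le refl → let a , b≤a , lo , hi = locate b j le in
          avoid (suc a) (ℕ.m≤n⇒m≤1+n b≤a) (proj₂ (preserved a j lo hi i) q′∈) }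

-- Joining finite blocks into an infinite path

module Concatenation {A : Set} (hd : ℕ → A) (tl : ℕ → List A) where

  -- The number is the index of the block to follow. Blocks come as head and tail, hence nonempty,
  -- so every index consumes one entry and the recursion is structural.
  joined : A → List A → ℕ → ℕ → A
  joined y ys       i zero    = y
  joined y []       i (suc l) = joined (hd i) (tl i) (suc i) l
  joined y (z ∷ zs) i (suc l) = joined z zs i l

  joinFrom : ℕ → ℕ → A
  joinFrom i = joined (hd i) (tl i) (suc i)

  joined-prefix : ∀ y ys i → applyUpTo (joined y ys i) (length (y ∷ ys)) ≡ y ∷ ys
  joined-prefix y []       i = refl
  joined-prefix y (z ∷ zs) i = cong (y ∷_) (joined-prefix z zs i)

  joined-drop : ∀ y ys i l → joined y ys i (length (y ∷ ys) ℕ.+ l) ≡ joinFrom i l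
  joined-drop y []       i l = refl
  joined-drop y (z ∷ zs) i l = joined-drop z zs i l

  len cut : ℕ → ℕ
  len i = length (hd i ∷ tl i)
  cut zero    = 0
  cut (suc i) = cut i ℕ.+ len i

  joinFrom-cut : ∀ i l → joinFrom 0 (cut i ℕ.+ l) ≡ joinFrom i l
  joinFrom-cut zero    l = refl
  joinFrom-cut (suc i) l = trans (cong (joinFrom 0) (ℕ.+-assoc (cut i) (len i) l))
    (trans (joinFrom-cut i (len i ℕ.+ l)) (joined-drop (hd i) (tl i) (suc i) l))

  joinFrom-segment : ∀ i → applyUpTo (λ l → joinFrom 0 (cut i ℕ.+ l)) (len i) ≡ hd i ∷ tl i
  joinFrom-segment i =
    trans (applyUpTo-cong (joinFrom-cut i) (len i)) (joined-prefix (hd i) (tl i) (suc i))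

module _ {n k : ℕ} (M : MC n k) (hd : ℕ → Triple n k) (tl : ℕ → List (Triple n k))
         (path : ∀ i → IsPath M (hd i ∷ tl i))
         (link : ∀ i → lastState (hd i ∷ tl i) ≡ just (src (hd (suc i)))) where
  open Concatenation hd tl

  joined-infPath : ∀ y ys i → IsPath M (y ∷ ys) → lastState (y ∷ ys) ≡ just (src (hd i)) →
                   IsInfPath M (joined y ys i)
  joined-infPath y []       i (ey ∷ _ , _)       ls zero    = ey , Maybe.just-injective ls
  joined-infPath y (z ∷ zs) i (ey ∷ _ , yz ∷ _)  ls zero    = ey , yz
  joined-infPath y []       i _                  ls (suc l) =
    joined-infPath (hd i) (tl i) (suc i) (path i) (link i) l
  joined-infPath y (z ∷ zs) i (_ ∷ es , _ ∷ lk)  ls (suc l) = joined-infPath z zs i (es , lk) ls l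

  joinFrom-infPath : IsInfPath M (joinFrom 0)
  joinFrom-infPath = joined-infPath (hd 0) (tl 0) 1 (path 0) (link 0)

module _ {n k : ℕ} (M : MC n k) where

  shift-infPath : ∀ {ω} → IsInfPath M ω → ∀ i → IsInfPath M (λ l → ω (i ℕ.+ l))
  shift-infPath {ω} path i l = proj₁ (path (i ℕ.+ l)) ,
    trans (proj₂ (path (i ℕ.+ l))) (cong (src ∘ ω) (sym (ℕ.+-suc i l)))

  last-applyUpTo : ∀ {ω} → IsInfPath M ω → ∀ l → lastState (applyUpTo ω (suc l)) ≡ just (src (ω (suc l)))
  last-applyUpTo {ω} path l = trans (cong lastState (sym (List.applyUpTo-∷ʳ ω l)))
    (trans (lastState-∷ʳ (applyUpTo ω l) (ω l)) (cong just (proj₂ (path l))))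

  walks-complete : ∀ ω {s} → IsInfPath M ω → src (ω 0) ≡ s → ∀ d → applyUpTo ω d ∈ₗ walks s d
  walks-complete ω     path refl zero    = here refl
  walks-complete ω {s} path refl (suc d) =
    ∈-concatMap⁺ (λ x → map ((s , x) ∷_) (walks (proj₂ x) d)) (lose (steps-complete n k (proj₂ (ω 0)))
      (∈-map⁺ (ω 0 ∷_) (walks-complete (ω ∘ suc) (path ∘ suc) (sym (proj₂ (path 0))) d)))

-- Parsing infinite paths into blocks

module Transfer {n k m : ℕ} (M : MC n k) (A : DRA n m) (separated : LabelsSeparated A)
                (e : Triple n k) (edge : IsEdge M e) (r : Replaceable M A e)
                (em : ExcludedMiddle 0ℓ) where
  open MC M using (sinit)
  open Replaceable r
  open IsMCCS isMCCS
  open Replacement M A separated e edge r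

  -- Common to both directions: `ω′` is obtained from `ω` by cutting it, or `ω` from `ω′` by joining
  -- chosen expansions.
  record Parsing (ω ω′ : ℕ → Triple n k) : Set where
    field
      cut len  : ℕ → ℕ
      cut-zero : cut 0 ≡ 0
      cut-suc  : ∀ i → cut (suc i) ≡ cut i ℕ.+ len i
      segment  : ∀ i → Expansion (ω′ i) (applyUpTo (λ l → ω (cut i ℕ.+ l)) (len i))

    open Simulation A (label ∘ ω) (label ∘ ω′) cut len cut-zero cut-suc
      (λ i → subst (λ t → _∼_ A t [ label (ω′ i) ])
               (List.map-applyUpTo (λ l → ω (cut i ℕ.+ l)) label (len i)) (expansion-∼ (segment i)))
      public using (cut-≥; accepts⇔)

    applyUpTo-cut : ∀ i → applyUpTo ω (cut (suc i)) ≡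
                    applyUpTo ω (cut i) ++ applyUpTo (λ l → ω (cut i ℕ.+ l)) (len i)
    applyUpTo-cut i = trans (cong (applyUpTo ω) (cut-suc i)) (applyUpTo-+ ω (cut i) (len i))

    parsed : ∀ d → applyUpTo ω (cut d) ∈ₗ expand (applyUpTo ω′ d)
    parsed zero    = subst (λ j → applyUpTo ω j ∈ₗ expand []) (sym cut-zero) (here refl)
    parsed (suc d) = subst₂ _∈ₗ_ (sym (applyUpTo-cut d)) (cong expand (List.applyUpTo-∷ʳ ω′ d))
      (expand-∷ʳ (applyUpTo ω′ d) (parsed d) (segment d))

  module Parse (ω : ℕ → Triple n k) (path : IsInfPath M ω) where

    FirstBlock : (ℕ → Triple n k) → Set
    FirstBlock ω = ∃₂ λ l x → Expansion x (applyUpTo ω l) × src x ≡ src (ω 0) × tgt x ≡ src (ω l)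

    -- If the first edge is `e`, then `exhaust` supplies an MCCS prefix, and the replacing edge
    -- leads from the source of `e` to the state reached, with the equivalent label.
    firstBlock : ∀ ω → IsInfPath M ω → FirstBlock ω
    firstBlock ω path with ω 0 ≟ₜ e
    ... | no ne = 1 , ω 0 , keep (ne , proj₁ (path 0)) , refl , proj₂ (path 0)
    ... | yes start with exhaust ω path start
    ...   | zero  , Ti with () ← proj₂ (paths Ti)
    ...   | suc l , Ti with c , sim ← mccs-good M A e isMCCS Ti =
      suc l , (src e , c , src (ω (suc l))) , replace Ti (refl , sim , last-applyUpTo M path l) ,
      cong src (sym start) , refl

    position : ℕ → ℕ
    block    : ∀ i → FirstBlock (λ l → ω (position i ℕ.+ l))

    position zero    = 0
    position (suc i) = position i ℕ.+ proj₁ (block i)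

    block i = firstBlock (λ l → ω (position i ℕ.+ l)) (shift-infPath M path (position i))

    ω′ : ℕ → Triple n k
    ω′ i = proj₁ (proj₂ (block i))

    parsing : Parsing ω ω′
    parsing = record
      { cut      = position
      ; len      = λ i → proj₁ (block i)
      ; cut-zero = refl
      ; cut-suc  = λ _ → refl
      ; segment  = λ i → proj₁ (proj₂ (proj₂ (block i)))
      }

    ω′-src : ∀ i → src (ω′ i) ≡ src (ω (position i))
    ω′-src i = trans (proj₁ (proj₂ (proj₂ (proj₂ (block i)))))
                     (cong (src ∘ ω) (ℕ.+-identityʳ (position i)))

    ω′-infPath : IsInfPath R ω′
    ω′-infPath i = expansion-edge (Parsing.segment parsing i) ,
      trans (proj₂ (proj₂ (proj₂ (proj₂ (block i))))) (sym (ω′-src (suc i)))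

  -- From covers in the replaced chain to covers in the original one

  module _ (C : Family R) where

    expandedLevels : ℕ → List (List (Triple n k))
    expandedLevels i = maybe (expand ∘ proj₁) [] (C i)

    expandedLevels-mass : ∀ j → ∑ (applyUpTo expandedLevels j) (λ us → ∑ us (ℙ M)) ≡ partialMass R C j
    expandedLevels-mass = go C
      where
      single : ∀ c → ∑ (maybe (expand ∘ proj₁) [] c) (ℙ M) ≡ maybe (ℙ R ∘ proj₁) 0ℚ c
      single nothing        = refl
      single (just (q , _)) = ∑-expand q

      go : ∀ (C : Family R) j →
           ∑ (applyUpTo (maybe (expand ∘ proj₁) [] ∘ C) j) (λ us → ∑ us (ℙ M)) ≡ partialMass R C j
      go C zero    = refl
      go C (suc j) = cong₂ _+_ (single (C 0)) (go (C ∘ suc) j)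

    -- The parse of an accepting path is accepting, so it lies in some cylinder `q` of `C`; the
    -- first `length q` blocks of the path then form an expansion of `q`.
    expandedLevels-cover : Covers R C (λ (ω′ , _) → Accepts A (label ∘ ω′)) →
      ∀ (ω : PathsFromInit M) → Accepts A (label ∘ proj₁ ω) →
      ∃₂ λ d j → applyUpTo (proj₁ ω) j ∈ₗ expandedLevels d
    expandedLevels-cover cov (ω , path , start) acc
      with i , (q , _) , Ci , pre ←
        cov (Parse.ω′ ω path , Parse.ω′-infPath ω path , trans (Parse.ω′-src ω path 0) start)
          (Equivalence.to (Parsing.accepts⇔ (Parse.parsing ω path) em) acc) =
      i , Parsing.cut (Parse.parsing ω path) (length q) ,
      subst₂ (λ c q′ → applyUpTo ω (Parsing.cut (Parse.parsing ω path) (length q)) ∈ₗ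
                       maybe (expand ∘ proj₁) [] c)
        (sym Ci) pre
        (subst (λ q′ → applyUpTo ω (Parsing.cut (Parse.parsing ω path) (length q)) ∈ₗ expand q′) pre
          (Parsing.parsed (Parse.parsing ω path) (length q)))

  fromReplaced : ∀ ρ → ℙ[ R ⊨ A ] ρ → ℙ[ M ⊨ A ] ρ
  fromReplaced ρ (C , cov , r′ , r′<ρ , h) =
    cover M (expandedLevels C) , cover-covers M (expandedLevels C) (expandedLevels-cover C cov) ,
    r′ , r′<ρ , cover-mass M (expandedLevels C) λ j → subst (_≤ r′) (sym (expandedLevels-mass C j)) (h j)

  -- From covers in the original chain to covers in the replaced one

  module _ (C : Family M) where

    Hit : ℕ → List (Triple n k) → Set
    Hit d u = ∃₂ λ j c → j ℕ.< d × C j ≡ just c × proj₁ c ⊑ u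

    hit-mono : ∀ {d d′ u u′} → d ℕ.≤ d′ → u ⊑ u′ → Hit d u → Hit d′ u′
    hit-mono d≤ u⊑ (j , c , j< , Cj , pre) = j , c , ℕ.<-≤-trans j< d≤ , Cj , ⊑-trans pre u⊑

    Settled : ℕ → List (Triple n k) → Set
    Settled d q = ∀ u → u ∈ₗ expand q → Hit d u

    settled-mono : ∀ {d d′ q q′} → d ℕ.≤ d′ → q ⊑ q′ → Settled d q → Settled d′ q′
    settled-mono d≤ q⊑ settled u u∈ with u′ , u′∈ , pre ← expand-⊑ q⊑ u∈ = hit-mono d≤ pre (settled u′ u′∈)

    settled? : ∀ d q → Dec (Settled d q)
    settled? d q = em

    -- Settledness persists under extension. Admitting a path only if its prefix was not yet settled
    -- keeps the cylinders of different levels disjoint, so that their masses add up.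
    New : ℕ → List (Triple n k) → Set
    New d q = Settled (suc d) q × ¬ Settled d (take d q)

    new? : ∀ d q → Dec (New d q)
    new? d q = em

    settledLevels : ℕ → List (List (Triple n k))
    settledLevels zero    = filter (settled? 0) (walks sinit 0)
    settledLevels (suc d) = filter (new? d) (walks sinit (suc d))

    settledMass : ℕ → ℚ
    settledMass d = ∑ (walks sinit d) (λ q → when (settled? d q) (ℙ R q))

    -- The settled mass at length `suc d` contains the mass inherited from settled prefixes of
    -- length `d` and, disjointly, that of the new paths.
    settledLevels-mass : ∀ d → ∑ (applyUpTo settledLevels (suc d)) (λ us → ∑ us (ℙ R)) ≤ settledMass d
    settledLevels-mass zero = ℚ.≤-reflexive
      (trans (ℚ.+-identityʳ (∑ (settledLevels 0) (ℙ R))) (∑-filter (settled? 0) (walks sinit 0) (ℙ R)))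
    settledLevels-mass (suc d) = begin
      ∑ (applyUpTo settledLevels (suc (suc d))) total
        ≡⟨ cong (λ ls → ∑ ls total) (sym (List.applyUpTo-∷ʳ settledLevels (suc d))) ⟩
      ∑ (applyUpTo settledLevels (suc d) ++ [ settledLevels (suc d) ]) total
        ≡⟨ ∑-++ (applyUpTo settledLevels (suc d)) [ settledLevels (suc d) ] total ⟩
      ∑ (applyUpTo settledLevels (suc d)) total + (total (settledLevels (suc d)) + 0ℚ)
        ≤⟨ ℚ.+-mono-≤ (settledLevels-mass d) (ℚ.≤-reflexive
             (trans (ℚ.+-identityʳ (total (settledLevels (suc d)))) (∑-filter (new? d) (walks sinit (suc d)) (ℙ R)))) ⟩
      settledMass d + ∑ (walks sinit (suc d)) new
        ≡⟨ cong (_+ ∑ (walks sinit (suc d)) new) (sym (∑-walks-take R sinit d (settled? d))) ⟩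
      ∑ (walks sinit (suc d)) old + ∑ (walks sinit (suc d)) new
        ≡⟨ sym (∑-+ (walks sinit (suc d)) old new) ⟩
      ∑ (walks sinit (suc d)) (λ q → old q + new q)
        ≤⟨ ∑-mono (walks sinit (suc d)) (λ q _ → step q (settled? d (take d q)) (new? d q) (settled? (suc d) q)) ⟩
      settledMass (suc d) ∎
      where
      open ℚ.≤-Reasoning
      total : List (List (Triple n k)) → ℚ
      total us = ∑ us (ℙ R)
      old new : List (Triple n k) → ℚ
      old q = when (settled? d (take d q)) (ℙ R q)
      new q = when (new? d q) (ℙ R q)

      step : ∀ q (g : Dec (Settled d (take d q))) (ν : Dec (New d q)) (g′ : Dec (Settled (suc d) q)) →
             when g (ℙ R q) + when ν (ℙ R q) ≤ when g′ (ℙ R q)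
      step q (yes g) (yes ν) g′       = contradiction g (proj₂ ν)
      step q (yes g) (no _)  (yes _)  = ℚ.≤-reflexive (ℚ.+-identityʳ (ℙ R q))
      step q (yes g) (no _)  (no ¬g′) = contradiction (settled-mono (ℕ.n≤1+n d) (take-⊑ d q) g) ¬g′
      step q (no _)  (yes ν) (yes _)  = ℚ.≤-reflexive (ℚ.+-identityˡ (ℙ R q))
      step q (no _)  (yes ν) (no ¬g′) = contradiction (proj₁ ν) ¬g′
      step q (no _)  (no _)  g′       = when-≥0 g′ (0≤ℙ R q)

    -- Spread each settled path over its expansions. Each of these lies below one of the first `d`
    -- cylinders, and by `∑-below` no cylinder receives more than its own mass.
    settledMass-≤ : ∀ d → settledMass d ≤ partialMass M C d
    settledMass-≤ d = begin
      ∑ (walks sinit d) (λ q → when (settled? d q) (ℙ R q))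
        ≤⟨ ∑-mono (walks sinit d) (λ q _ → expanded q (settled? d q)) ⟩
      ∑-expand-walks sinit d (λ u → ∑ (applyUpTo C d) (λ c → weight c u))
        ≡⟨ ∑-cong (walks sinit d) (λ q _ → ∑-swap (expand q) (applyUpTo C d) (λ u c → weight c u)) ⟩
      ∑ (walks sinit d) (λ q → ∑ (applyUpTo C d) (λ c → ∑ (expand q) (weight c)))
        ≡⟨ ∑-swap (walks sinit d) (applyUpTo C d) (λ q c → ∑ (expand q) (weight c)) ⟩
      ∑ (applyUpTo C d) (λ c → ∑-expand-walks sinit d (weight c))
        ≤⟨ ∑-mono (applyUpTo C d) (λ c _ → cylinder c) ⟩
      partialMass M C d ∎
      where
      open ℚ.≤-Reasoning
      weight : Maybe (Certified M) → List (Triple n k) → ℚ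
      weight c u = maybe (λ p → below (proj₁ p) u) 0ℚ c

      0≤weight : ∀ u c → 0ℚ ≤ weight c u
      0≤weight u nothing  = ℚ.≤-refl
      0≤weight u (just p) = 0≤below (proj₁ p) u

      expanded : ∀ q (g : Dec (Settled d q)) →
                 when g (ℙ R q) ≤ ∑ (expand q) (λ u → ∑ (applyUpTo C d) (λ c → weight c u))
      expanded q (no _)     = ∑-≥0 (expand q) λ u → ∑-≥0 (applyUpTo C d) (0≤weight u)
      expanded q (yes settled) = subst (_≤ ∑ (expand q) (λ u → ∑ (applyUpTo C d) (λ c → weight c u))) (∑-expand q)
        (∑-mono (expand q) λ u u∈ → hit u (settled u u∈))
        where
        hit : ∀ u → Hit d u → ℙ M u ≤ ∑ (applyUpTo C d) (λ c → weight c u)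
        hit u (j , p , j< , Cj , pre) = ℚ.≤-trans
          (ℚ.≤-reflexive (sym (trans (cong (λ c → weight c u) Cj) (when-yes (proj₁ p ≼? u) pre))))
          (term≤∑ (applyUpTo C d) (0≤weight u) (∈-applyUpTo⁺ C j<))

      cylinder : ∀ c → ∑-expand-walks sinit d (weight c) ≤ maybe (ℙ M ∘ proj₁) 0ℚ c
      cylinder (just (p , path , start)) = ∑-below d sinit p path start
      cylinder nothing = ℚ.≤-reflexive (trans
        (∑-cong (walks sinit d) λ q _ → ∑-zero (expand q)) (∑-zero (walks sinit d)))

    -- Descends to a length at which settledness first appears, since the levels contain only such
    -- prefixes.
    settledLevels-∈ : ∀ ω′ → IsInfPath R ω′ → src (ω′ 0) ≡ sinit → ∀ d → Settled d (applyUpTo ω′ d) →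
                      ∃₂ λ d j → applyUpTo ω′ j ∈ₗ settledLevels d
    settledLevels-∈ ω′ path start zero settled =
      0 , 0 , ∈-filter⁺ (settled? 0) (walks-complete R ω′ path start 0) settled
    settledLevels-∈ ω′ path start (suc d) settled with em {Settled d (applyUpTo ω′ d)}
    ... | yes settled′ = settledLevels-∈ ω′ path start d settled′
    ... | no ¬settled  = suc d , suc d , ∈-filter⁺ (new? d) (walks-complete R ω′ path start (suc d))
      (settled , ¬settled ∘ subst (Settled d) (take-applyUpTo ω′ d))

    -- König's lemma: if no prefix of ω′ is settled, then some infinite path of M
    -- that parses to ω′ avoids every cylinder of C.

    module Koenig (ω′ : ℕ → Triple n k) (path : IsInfPath R ω′)
                  (¬settled : ∀ d → ¬ Settled d (applyUpTo ω′ d)) where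

      next : ℕ → ℕ → List (Triple n k)
      next i = applyUpTo (λ l → ω′ (i ℕ.+ l))

      next-suc : ∀ i d → next i (suc d) ≡ ω′ i ∷ next (suc i) d
      next-suc i d = cong₂ _∷_ (cong ω′ (ℕ.+-identityʳ i))
        (applyUpTo-cong (λ l → cong ω′ (ℕ.+-suc i l)) d)

      -- The analogue of an infinite subtree at the node `v`, reached after `i` blocks: at every
      -- further depth some descendant escapes the cylinders considered at that depth.
      Bad : ℕ → List (Triple n k) → Set
      Bad i v = ∀ d → ∃ λ u → u ∈ₗ expand (next i d) × ¬ Hit (i ℕ.+ d) (v ++ u)

      Covered : ℕ → List (Triple n k) → ℕ → Set
      Covered i v d = ∀ u → u ∈ₗ expand (next i d) → Hit (i ℕ.+ d) (v ++ u)

      covered-mono : ∀ i v {d d′} → d ℕ.≤ d′ → Covered i v d → Covered i v d′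
      covered-mono i v d≤ h u u∈
        with u′ , u′∈ , pre ← expand-⊑ (applyUpTo-⊑ (λ l → ω′ (i ℕ.+ l)) d≤) u∈ =
        hit-mono (ℕ.+-monoʳ-≤ i d≤) (++-⊑⁺ v pre) (h u′ u′∈)

      ¬covered⇒witness : ∀ i v d → ¬ Covered i v d → ∃ λ u → u ∈ₗ expand (next i d) × ¬ Hit (i ℕ.+ d) (v ++ u)
      ¬covered⇒witness i v d ¬cov with em {∃ λ u → u ∈ₗ expand (next i d) × ¬ Hit (i ℕ.+ d) (v ++ u)}
      ... | yes h = h
      ... | no ¬h = contradiction cov ¬cov
        where
        cov : Covered i v d
        cov u u∈ with em {Hit (i ℕ.+ d) (v ++ u)}
        ... | yes hit = hit
        ... | no ¬hit = contradiction (u , u∈ , ¬hit) ¬h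

      ¬bad⇒covered : ∀ i v → ¬ Bad i v → ∃ (Covered i v)
      ¬bad⇒covered i v ¬bad with em {∃ (Covered i v)}
      ... | yes h = h
      ... | no ¬h = contradiction (λ d → ¬covered⇒witness i v d λ cov → ¬h (d , cov)) ¬bad

      -- The tree branches finitely. If every child were covered from some depth on, `uniform-bound`
      -- would give a common depth `d`, and `v` itself would be covered at depth `suc d`.
      bad-step : ∀ i v → Bad i v → ∃ λ b → Expansion (ω′ i) b × Bad (suc i) (v ++ b)
      bad-step i v bad with em {∃ λ b → Expansion (ω′ i) b × Bad (suc i) (v ++ b)}
      ... | yes h = h
      ... | no ¬h = contradiction hit (proj₂ (proj₂ (bad (suc d))))
        where
        uniform : ∃ λ d → ∀ b → b ∈ₗ expansions (ω′ i) → Covered (suc i) (v ++ b) d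
        uniform = uniform-bound (λ b → covered-mono (suc i) (v ++ b)) (expansions (ω′ i))
          λ b b∈ → ¬bad⇒covered (suc i) (v ++ b) λ bad′ → ¬h (b , expansion⁻ b∈ , bad′)

        d : ℕ
        d = proj₁ uniform

        u : List (Triple n k)
        u = proj₁ (bad (suc d))

        hit : Hit (i ℕ.+ suc d) (v ++ u)
        hit with b , u′ , b∈ , u′∈ , eq ← ∈-cartesianProductWith⁻ _++_ (expansions (ω′ i)) (expand (next (suc i) d))
                   (subst (λ q → u ∈ₗ expand q) (next-suc i d) (proj₁ (proj₂ (bad (suc d))))) =
          subst₂ Hit (sym (ℕ.+-suc i d)) (trans (List.++-assoc v b u′) (cong (v ++_) (sym eq)))
            (proj₂ uniform b b∈ u′ u′∈)

      bad : ∀ i → ∃ (Bad i)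
      bad zero    = [] , λ d → ¬covered⇒witness 0 [] d (¬settled d)
      bad (suc i) = let b , _ , h = bad-step i (proj₁ (bad i)) (proj₂ (bad i)) in proj₁ (bad i) ++ b , h

      chosen : ∀ i → ∃ λ b → Expansion (ω′ i) b × Bad (suc i) (proj₁ (bad i) ++ b)
      chosen i = bad-step i (proj₁ (bad i)) (proj₂ (bad i))

      hd : ℕ → Triple n k
      hd i = proj₁ (expansion-head (proj₁ (proj₂ (chosen i))))

      tl : ℕ → List (Triple n k)
      tl i = proj₁ (proj₂ (expansion-head (proj₁ (proj₂ (chosen i)))))

      chosen≡ : ∀ i → proj₁ (chosen i) ≡ hd i ∷ tl i
      chosen≡ i = proj₁ (proj₂ (proj₂ (expansion-head (proj₁ (proj₂ (chosen i))))))

      hd-src : ∀ i → src (hd i) ≡ src (ω′ i)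
      hd-src i = proj₂ (proj₂ (proj₂ (expansion-head (proj₁ (proj₂ (chosen i))))))

      expansion : ∀ i → Expansion (ω′ i) (hd i ∷ tl i)
      expansion i = subst (Expansion (ω′ i)) (chosen≡ i) (proj₁ (proj₂ (chosen i)))

      open Concatenation hd tl using (joinFrom; joinFrom-segment) renaming (cut to cutᵒ; len to lenᵒ)

      ω : ℕ → Triple n k
      ω = joinFrom 0

      ω-infPath : IsInfPath M ω
      ω-infPath = joinFrom-infPath M hd tl (λ i → expansion-path (expansion i)) λ i →
        trans (expansion-last (expansion i)) (cong just (trans (proj₂ (path i)) (sym (hd-src (suc i)))))

      parsing : Parsing ω ω′
      parsing = record
        { cut      = cutᵒ
        ; len      = lenᵒ
        ; cut-zero = refl
        ; cut-suc  = λ _ → refl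
        ; segment  = λ i → subst (Expansion (ω′ i)) (sym (joinFrom-segment i)) (expansion i)
        }

      bad-prefix : ∀ i → proj₁ (bad i) ≡ applyUpTo ω (cutᵒ i)
      bad-prefix zero    = refl
      bad-prefix (suc i) = trans
        (cong₂ _++_ (bad-prefix i) (trans (chosen≡ i) (sym (joinFrom-segment i))))
        (sym (Parsing.applyUpTo-cut parsing i))

      uncovered : ∀ {j c} → C j ≡ just c → applyUpTo ω (length (proj₁ c)) ≢ proj₁ c
      uncovered {j} {c} Cj eq =
        let u , _ , ¬hit = proj₂ (bad i) 0
        in ¬hit (j , c , ℕ.≤-trans (ℕ.m≤m+n (suc j) (length (proj₁ c))) (ℕ.m≤m+n i 0) , Cj ,
             ⊑-trans (subst (proj₁ c ⊑_) (sym (bad-prefix i)) (prefix-of-stream ω (cutᵒ i) long eq))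
               (⊑-++ (proj₁ (bad i)) u))
        where
        i : ℕ
        -- Large enough for cylinder `j` to be among the first `i` ones and for `i` nonempty blocks
        -- to be at least as long as its path.
        i = suc j ℕ.+ length (proj₁ c)
        long : length (proj₁ c) ℕ.≤ cutᵒ i
        long = ℕ.≤-trans (ℕ.m≤n+m (length (proj₁ c)) (suc j)) (Parsing.cut-≥ parsing i)

    -- Without a settled prefix, König's lemma gives a path `ω` parsing to the accepting `ω′`. It is
    -- accepting too, hence covered by `C`, against `uncovered`.
    settledLevels-cover : Covers M C (λ (ω , _) → Accepts A (label ∘ ω)) →
      ∀ (ω′ : PathsFromInit R) → Accepts A (label ∘ proj₁ ω′) →
      ∃₂ λ d j → applyUpTo (proj₁ ω′) j ∈ₗ settledLevels d
    settledLevels-cover cov (ω′ , path , start) acc with em {∃ λ d → Settled d (applyUpTo ω′ d)}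
    ... | yes (d , settled) = settledLevels-∈ ω′ path start d settled
    ... | no ¬h =
      let _ , _ , Cj , pre = cov (ω , ω-infPath , trans (hd-src 0) start)
                               (Equivalence.from (Parsing.accepts⇔ parsing em) acc)
      in contradiction pre (uncovered Cj)
      where open Koenig ω′ path (λ d settled → ¬h (d , settled))

  toReplaced : ∀ ρ → ℙ[ M ⊨ A ] ρ → ℙ[ R ⊨ A ] ρ
  toReplaced ρ (C , cov , r′ , r′<ρ , h) =
    cover R (settledLevels C) , cover-covers R (settledLevels C) (settledLevels-cover C cov) ,
    r′ , r′<ρ , cover-mass R (settledLevels C) mass≤
    where
    mass≤ : ∀ j → ∑ (applyUpTo (settledLevels C) j) (λ us → ∑ us (ℙ R)) ≤ r′
    -- With no levels the claim is that `r′` is nonnegative, which is the bound on the empty partial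
    -- mass of `C`.
    mass≤ zero    = h 0
    mass≤ (suc d) = ℚ.≤-trans (settledLevels-mass C d) (ℚ.≤-trans (settledMass-≤ C d) (h d))

theorem19 : ExcludedMiddle 0ℓ →
    {n k m : ℕ} (M : MC n k) (A : DRA n m) →
    (separated : LabelsSeparated A) →
    (e : Triple n k) (edge : IsEdge M e) (r : Replaceable M A e) →
    ℙ[ M ⊨ A ] ≃ ℙ[ replacedMC M A e r separated edge ⊨ A ]
theorem19 em M A separated e edge r ρ = mk⇔ (toReplaced ρ) (fromReplaced ρ)
  where open Transfer M A separated e edge r em
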